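{- For every integer $m\ge1$, the lattices $\mathbb{Z}^{4m}$, $D_{4m}$ and $D_{4m}^+$, as well as the lattice $E_8$, the Coxeter–Todd lattice $K_{12}$, the Barnes–Wall lattice $BW_{16}$ and the Leech lattice $\Lambda_{24}$, each have a multiplier of norm $c$ for every positive integer $c$.
   Context: A similarity of norm $c$ is a linear map $\sigma:\mathbb{R}^n\to\mathbb{R}^n$ with $\sigma u\cdot\sigma v=c\,u\cdot v$ for all $u,v$. A multiplier of norm $c$ for a lattice $\Lambda$ is a similarity $\sigma$ of norm $c$ with $\sigma(\Lambda)\subseteq\Lambda$. $D_n$ is the lattice of integer vectors in $\mathbb{Z}^n$ with even coordinate sum, and $D_n^+=D_n\cup(D_n+(\tfrac12,\dots,\tfrac12))$. -}

module Defs where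

open import Data.Nat as ℕ using (ℕ; zero; suc; _%_; _/_; _≡ᵇ_)
open import Data.Integer as ℤ using (ℤ; +_)
open import Data.Integer.Divisibility using (_∣_)
open import Data.Rational as ℚ using (ℚ; ½)
open import Data.Fin using (Fin; toℕ; fromℕ<; combine)
open import Data.Bool using (Bool; true; false; if_then_else_)
open import Data.List using (upTo)
open import Data.Bool.ListAction using (any)
open import Relation.Nullary using (yes; no)
open import Data.Product using (Σ; _×_)
open import Data.Sum using (_⊎_)
open import Relation.Binary.PropositionalEquality using (_≡_)

Vecℚ : ℕ → Set
Vecℚ n = Fin n → ℚ

Vecℤ : ℕ → Set
Vecℤ n = Fin n → ℤ

Mat : ℕ → Set
Mat n = Fin n → Fin n → ℚ

∑ℚ : ∀ {n} → (Fin n → ℚ) → ℚ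
∑ℚ {zero}  f = ℚ.0ℚ
∑ℚ {suc n} f = f Fin.zero ℚ.+ ∑ℚ (λ i → f (Fin.suc i))
  where import Data.Fin as Fin

∑ℤ : ∀ {n} → (Fin n → ℤ) → ℤ
∑ℤ {zero}  f = + 0
∑ℤ {suc n} f = f Fin.zero ℤ.+ ∑ℤ (λ i → f (Fin.suc i))
  where import Data.Fin as Fin

apply : ∀ {n} → Mat n → Vecℚ n → Vecℚ n
apply σ x i = ∑ℚ (λ j → σ i j ℚ.* x j)

Form : ℕ → Set
Form n = Fin n → Fin n → ℚ

inner : ∀ {n} → Form n → Vecℚ n → Vecℚ n → ℚ
inner G u v = ∑ℚ (λ i → ∑ℚ (λ j → u i ℚ.* (G i j ℚ.* v j)))

dot : ∀ {n} → Vecℚ n → Vecℚ n → ℚ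
dot u v = ∑ℚ (λ i → u i ℚ.* v i)

IsSimilarity : ∀ {n} → (Vecℚ n → Vecℚ n → ℚ) → Mat n → ℚ → Set
IsSimilarity ip σ c = ∀ u v → ip (apply σ u) (apply σ v) ≡ c ℚ.* ip u v

Lattice : ℕ → Set₁
Lattice n = Vecℚ n → Set

IsMultiplier : ∀ {n} → (Vecℚ n → Vecℚ n → ℚ) → Lattice n → Mat n → ℚ → Set
IsMultiplier ip Λ σ c = IsSimilarity ip σ c × (∀ x → Λ x → Λ (apply σ x))

HasMultiplier : ∀ {n} → (Vecℚ n → Vecℚ n → ℚ) → Lattice n → ℚ → Set
HasMultiplier {n} ip Λ c = Σ (Mat n) (λ σ → IsMultiplier ip Λ σ c)

IntVecWith : ∀ {n} → (Vecℤ n → Set) → Lattice n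
IntVecWith {n} P x = Σ (Vecℤ n) (λ y → (∀ i → x i ≡ (y i ℚ./ 1)) × P y)

Zlat : (n : ℕ) → Lattice n
Zlat n = IntVecWith (λ _ → Data.Unit.⊤)
  where import Data.Unit

Dlat : (n : ℕ) → Lattice n
Dlat n = IntVecWith (λ y → + 2 ∣ ∑ℤ y)

Dplus : (n : ℕ) → Lattice n
Dplus n x = Dlat n x ⊎ Dlat n (λ i → x i ℚ.- ½)

-- E₈ = D₈⁺ (Conway–Sloane, SPLAG Ch. 4 §8.1)
E8 : Lattice 8
E8 = Dplus 8

-- Barnes–Wall lattice BW₁₆, scaled by √2 (Conway–Sloane Ch. 4 §10):
-- x ∈ ℤ¹⁶ with (x mod 2) in the first-order Reed–Muller code RM(1,4)
-- and coordinate sum ≡ 0 (mod 4).  Coordinates are indexed by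
-- i ∈ Fin 16 ≅ 𝔽₂⁴ via the binary digits of i; RM(1,4) consists of the
-- words i ↦ a₀ + Σₖ aₖ·bitₖ(i).
bit : ℕ → ℕ → ℤ
bit k i = + (shiftR k i % 2)
  where
  shiftR : ℕ → ℕ → ℕ
  shiftR zero    i = i
  shiftR (suc k) i = shiftR k (i / 2)

BW16 : Lattice 16
BW16 = IntVecWith (λ y →
  Σ ℤ (λ a₀ → Σ (Vecℤ 4) (λ a →
    (∀ i → + 2 ∣ (y i ℤ.- (a₀ ℤ.+ ∑ℤ (λ k → a k ℤ.* bit (toℕ k) (toℕ i)))))
    × (+ 4 ∣ ∑ℤ y))))

-- Leech lattice Λ₂₄, scaled by √8 (Conway–Sloane Ch. 4 §11):
-- x ∈ ℤ²⁴ such that for some m, all xᵢ ≡ m + 2 wᵢ (mod 4) for a word w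
-- of the extended binary Golay code 𝒞₂₄, and Σ xᵢ ≡ 4m (mod 8).
-- 𝒞₂₄ is the extended quadratic-residue code of length 24: the 𝔽₂-span
-- of the 23 cyclic shifts of the indicator of the nonzero squares mod 23,
-- extended (coordinate 23 = "∞") by an overall parity bit.

qr23 : ℕ → ℤ
qr23 k = if any (λ t → ((t ℕ.* t) % 23) ≡ᵇ k) (Data.List.map suc (upTo 22))
         then + 1 else + 0
  where import Data.List

-- word of the cyclic QR code of length 23 with coefficient vector a
-- (entries read mod 2): wᵢ = Σⱼ aⱼ · qr((i − j) mod 23)
qrWord : Vecℤ 23 → Fin 23 → ℤ
qrWord a i = ∑ℤ (λ j → a j ℤ.* qr23 ((toℕ i ℕ.+ 23 ℕ.∸ toℕ j) % 23))

golayWord : Vecℤ 23 → Fin 24 → ℤ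
golayWord a i with toℕ i ℕ.<? 23
... | yes p = qrWord a (fromℕ< p)
... | no _  = ∑ℤ (qrWord a)

Leech : Lattice 24
Leech = IntVecWith (λ y →
  Σ ℤ (λ m → Σ (Vecℤ 23) (λ a →
    (∀ i → + 4 ∣ (y i ℤ.- (m ℤ.+ + 2 ℤ.* golayWord a i)))
    × (+ 8 ∣ (∑ℤ y ℤ.- + 4 ℤ.* m)))))

-- Coxeter–Todd lattice K₁₂ (Conway–Sloane Ch. 4 §9, complex form):
-- K₁₂ = { (z₁,…,z₆) ∈ 𝓔⁶ : zₖ ≡ zₗ (mod θ) for all k,l, Σ zₖ ≡ 0 (mod 3) }
-- with 𝓔 = ℤ[ω] the Eisenstein integers, θ = ω − ω̄ = √−3, regarded as a
-- real 12-dimensional lattice with inner product Re Σ zₖ w̄ₖ.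
-- We use real coordinates w.r.t. the ℝ-basis (1, ω) of each ℂ factor:
-- coordinate 2k is aₖ and 2k+1 is bₖ where zₖ = aₖ + bₖ ω.  In these
-- coordinates Re(z w̄) for z = a+bω, w = c+dω is ac + bd − (ad + bc)/2,
-- i.e. the Gram matrix is block diagonal with blocks [[1,−½],[−½,1]].
-- Since 𝓔/θ ≅ 𝔽₃ via a + bω ↦ a + b, zₖ ≡ zₗ (mod θ) iff
-- 3 ∣ (aₖ + bₖ) − (aₗ + bₗ); Σ zₖ ≡ 0 (mod 3) iff 3 ∣ Σ aₖ and 3 ∣ Σ bₖ.
K12form : Form 12
K12form i j with toℕ i / 2 ℕ.≡ᵇ toℕ j / 2 | toℕ i ℕ.≡ᵇ toℕ j
... | true  | true  = ℚ.1ℚ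
... | true  | false = ℚ.- ½
... | false | _     = ℚ.0ℚ

K12inner : Vecℚ 12 → Vecℚ 12 → ℚ
K12inner = inner K12form

-- coordinates of the k-th Eisenstein coordinate zₖ = aₖ + bₖ ω :
-- aₖ = y (2k), bₖ = y (2k+1)   (combine k b = 2k + b)
coordA coordB : Vecℤ 12 → Fin 6 → ℤ
coordA y k = y (combine {6} {2} k Fin.zero)
  where import Data.Fin as Fin
coordB y k = y (combine {6} {2} k (Fin.suc Fin.zero))
  where import Data.Fin as Fin

K12 : Lattice 12
K12 = IntVecWith (λ y →
  (∀ k l → + 3 ∣ ((coordA y k ℤ.+ coordB y k) ℤ.- (coordA y l ℤ.+ coordB y l)))
  × (+ 3 ∣ ∑ℤ (coordA y)) × (+ 3 ∣ ∑ℤ (coordB y)))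

-- Suppose I and J act on a lattice by isometries with I² = - t I - 1, J² = - 1 and I J = J Ī. Then a + b I + c J + d J I
-- is a multiplier of norm N = (a² - t a b + b²) + (c² - t c d + d²), so it suffices to find such I and J and to show that N
-- represents every positive integer.
--
-- For t = 0, N is the sum of four squares, and I, J are anticommuting signed permutations: left multiplication by the
-- quaternions i, j on blocks of four coordinates for ℤ⁴ᵐ, D₄ₘ, D₄ₘ⁺ and BW₁₆, and two commuting fixed-point-free involutions
-- of PSL₂(23), with Golay codewords as sign changes, for Λ₂₄. For K₁₂ we take t = 1, I = ω and an antilinear J.
--
-- N is multiplicative, and represents a prime p by descent: if N x = m p with 1 < m < p and r = x - m k is reduced mod m,
-- then N r = m m′ with m′ < m, and N (p - x k̄) = p m′.

module Submission where

open import Defs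
open import Algebra.Bundles using (Semiring; CommutativeRing)
import Algebra.Properties.Semiring.Sum as SemiringSum
open import Data.Bool using (Bool; true; false; not; if_then_else_; _xor_)
open import Data.Bool.Properties using () renaming (_≟_ to _≟ᵇ_)
open import Data.Fin as Fin using (Fin; zero; suc; _≟_; combine; remQuot; toℕ; fromℕ<; splitAt; #_)
open import Data.Fin.Patterns
open import Data.Fin.Permutation using (Permutation; permutation)
import Data.Fin.Properties as Finₚ
open import Data.Integer as ℤ using (ℤ; +_; -[1+_]; +[1+_]; ∣_∣; _⊖_)
open import Data.Integer.Divisibility using (_∣_)
import Data.Integer.Divisibility.Signed as Signed
open import Data.Integer.DivMod using (_/ℕ_; _%ℕ_; n%ℕd<d; a≡a%ℕn+[a/ℕn]*n)
import Data.Integer.Properties as ℤₚ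
import Data.Integer.Solver
open import Data.List using ([]; _∷_)
open import Data.List.Relation.Unary.All using (All; []; _∷_)
open import Data.Nat as ℕ using (ℕ; zero; suc; z≤n; s≤s)
import Data.Nat.Divisibility as ℕᵈ
open import Data.Nat.Induction using (<-wellFounded)
open import Data.Nat.ListAction using (product)
open import Data.Nat.Primality using (Prime; prime?; ¬prime[1]; prime⇒irreducible; prime⇒nonZero; euclidsLemma)
open import Data.Nat.Primality.Factorisation using (PrimeFactorisation; factorise)
import Data.Nat.Properties as ℕₚ
import Data.Nat.Solver
open import Data.Product using (Σ; ∃; ∃₂; _×_; _,_; proj₁; proj₂)
open import Data.Rational as ℚ using (ℚ; 0ℚ; 1ℚ; ½; toℚᵘ)
import Data.Rational.Properties as ℚₚ
import Data.Rational.Solver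
import Data.Rational.Unnormalised as ℚᵘ
import Data.Rational.Unnormalised.Properties as ℚᵘₚ
open import Data.Sum using (_⊎_; inj₁; inj₂)
open import Data.Unit using (tt)
open import Data.Vec using (Vec; []; _∷_; lookup)
open import Function using (_∘_)
open import Induction.WellFounded using (Acc; acc)
open import Level using (0ℓ)
open import Relation.Binary.PropositionalEquality
  using (_≡_; _≢_; refl; sym; trans; cong; cong₂; subst; subst₂; module ≡-Reasoning)
open import Relation.Nullary using (¬_; Dec; does; yes; no; contradiction)
open import Relation.Nullary.Decidable using (True; toWitness; from-yes; _×-dec_)

module ℕ-Solver = Data.Nat.Solver.+-*-Solver
module ℤ-Solver = Data.Integer.Solver.+-*-Solver
module ℚ-Solver = Data.Rational.Solver.+-*-Solver

module UniversalForms where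
  open import Data.Integer using (_+_; _*_; _-_; -_; +<+)
  open ℤ-Solver

  record Quat : Set where
    constructor quat
    field
      c₀ c₁ c₂ c₃ : ℤ

  norm² : ℤ → ℤ → ℤ → ℤ
  norm² t a b = a * a - t * a * b + b * b

  N : ℤ → Quat → ℤ
  N t (quat a b c d) = norm² t a b + norm² t c d

  -- quat a b c d stands for (a + b I) + (c + d I) J; then shift m x k = x - m k, cofactor t p x k = p - x k̄ and
  -- polar t x k = x k̄ + k x̄.
  polar : ℤ → Quat → Quat → ℤ
  polar t (quat a b c d) (quat e f g h) =
    + 2 * (a * e + b * f + c * g + d * h) - t * (a * f + b * e + c * h + d * g)

  shift : ℤ → Quat → Quat → Quat
  shift m (quat a b c d) (quat e f g h) =
    quat (a - m * e) (b - m * f) (c - m * g) (d - m * h)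

  cofactor : ℤ → ℤ → Quat → Quat → Quat
  cofactor t p (quat a b c d) (quat e f g h) = quat
    (p - (a * e - t * a * f + b * f + (c * g - t * c * h + d * h)))
    (- ((b * e - a * f) + (d * g - c * h)))
    ((c * e - d * f) - (a * g - b * h))
    ((c * f + d * e - t * d * f) - (a * h + b * g - t * b * h))

  norm²ᴾ : ∀ {n} (t a b : Polynomial n) → Polynomial n
  norm²ᴾ t a b = a :* a :- t :* a :* b :+ b :* b

  Nᴾ : ∀ {n} (t a b c d : Polynomial n) → Polynomial n
  Nᴾ t a b c d = norm²ᴾ t a b :+ norm²ᴾ t c d

  polarᴾ : ∀ {n} (t a b c d e f g h : Polynomial n) → Polynomial n
  polarᴾ t a b c d e f g h =
    con (+ 2) :* (a :* e :+ b :* f :+ c :* g :+ d :* h) :- t :* (a :* f :+ b :* e :+ c :* h :+ d :* g)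

  N-shift : ∀ t m x k → N t (shift m x k) ≡ N t x - m * polar t x k + m * m * N t k
  N-shift t m (quat a b c d) (quat e f g h) = solve 10 (λ t m a b c d e f g h →
    Nᴾ t (a :- m :* e) (b :- m :* f) (c :- m :* g) (d :- m :* h)
    := Nᴾ t a b c d :- m :* polarᴾ t a b c d e f g h :+ m :* m :* Nᴾ t e f g h) refl t m a b c d e f g h

  N-cofactor : ∀ t p x k → N t (cofactor t p x k) ≡ p * p - p * polar t x k + N t x * N t k
  N-cofactor t p (quat a b c d) (quat e f g h) = solve 10 (λ t p a b c d e f g h →
    Nᴾ t (p :- (a :* e :- t :* a :* f :+ b :* f :+ (c :* g :- t :* c :* h :+ d :* h)))
      (:- ((b :* e :- a :* f) :+ (d :* g :- c :* h)))
      ((c :* e :- d :* f) :- (a :* g :- b :* h))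
      ((c :* f :+ d :* e :- t :* d :* f) :- (a :* h :+ b :* g :- t :* b :* h))
    := p :* p :- p :* polarᴾ t a b c d e f g h :+ Nᴾ t a b c d :* Nᴾ t e f g h) refl t p a b c d e f g h

  Represented : ℤ → ℤ → Set
  Represented t n = ∃ λ x → N t x ≡ n

  represented-* : ∀ t {m n} → Represented t m → Represented t n → Represented t (m * n)
  represented-* t (x , refl) (y , refl) = cofactor t (+ 0) x y , trans (N-cofactor t (+ 0) x y) (ℤₚ.+-identityˡ _)

  Balanced : ℕ → ℤ → Set
  Balanced m u = ∣ u ∣ ℕ.< m ⊎ u ≡ + m

  balance : ∀ m .{{_ : ℕ.NonZero m}} y → ∃ λ k → Balanced m (y - + 2 * + m * k)
  balance m@(suc m-1) y = k , subst (Balanced m) (sym u≡) bal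
    where
    z = y + + m-1
    k = z /ℕ (2 ℕ.* m)
    s = z %ℕ (2 ℕ.* m)
    s<2m : s ℕ.< 2 ℕ.* m
    s<2m = n%ℕd<d z (2 ℕ.* m)
    u≡ : y - + 2 * + m * k ≡ suc s ⊖ m
    u≡ = begin
      y - + 2 * + m * k ≡⟨ cong (λ e → y - e * k) (sym (ℤₚ.pos-* 2 m)) ⟩
      y - + (2 ℕ.* m) * k ≡⟨ solve 4 (λ y r q k → y :- q :* k := (y :+ r) :- k :* q :- r) refl y (+ m-1) (+ (2 ℕ.* m))
          k ⟩
      z - k * + (2 ℕ.* m) - + m-1 ≡⟨ cong (λ e → e - k * + (2 ℕ.* m) - + m-1) (a≡a%ℕn+[a/ℕn]*n z (2 ℕ.* m)) ⟩
      (+ s + k * + (2 ℕ.* m)) - k * + (2 ℕ.* m) - + m-1 ≡⟨ solve 3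
          (λ s r w → (s :+ w) :- w :- r := (con (+ 1) :+ s) :- (con (+ 1) :+ r)) refl (+ s) (+ m-1) (k * + (2 ℕ.* m)) ⟩
      + suc s - + m ≡⟨ ℤₚ.m-n≡m⊖n (suc s) m ⟩
      suc s ⊖ m ∎
      where open ≡-Reasoning
    bal : Balanced m (suc s ⊖ m)
    bal with m ℕ.≤? suc s
    ... | yes m≤ = subst (Balanced m) (sym (ℤₚ.⊖-≥ m≤)) (small (ℕₚ.m≤n⇒m<n∨m≡n le))
      where
      le : suc s ℕ.∸ m ℕ.≤ m
      le = ℕₚ.≤-trans (ℕₚ.∸-monoˡ-≤ m s<2m) (ℕₚ.≤-reflexive (trans (cong (ℕ._∸ m) (cong (m ℕ.+_) (ℕₚ.+-identityʳ m)))
          (ℕₚ.m+n∸n≡m m m)))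
      small : ∀ {v} → v ℕ.< m ⊎ v ≡ m → Balanced m (+ v)
      small (inj₁ v<m) = inj₁ v<m
      small (inj₂ refl) = inj₂ refl
    ... | no m≰ = inj₁ (subst (ℕ._< m) (sym eq) (s≤s (ℕₚ.m∸n≤m m-1 s)))
      where
      eq : ∣ suc s ⊖ m ∣ ≡ m-1 ℕ.∸ s
      eq = trans (cong ∣_∣ (ℤₚ.⊖-< (ℕₚ.≰⇒> m≰))) (ℤₚ.∣-i∣≡∣i∣ (+ (m-1 ℕ.∸ s)))

  sq : ℤ → ℕ
  sq u = ∣ u ∣ ℕ.* ∣ u ∣

  sq-nonneg : ∀ u → u * u ≡ + sq u
  sq-nonneg (+ n) = sym (ℤₚ.pos-* n n)
  sq-nonneg -[1+ n ] = refl

  sq≤ : ∀ {m u} → Balanced m u → sq u ℕ.≤ m ℕ.* m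
  sq≤ (inj₁ u<m) = ℕₚ.*-mono-≤ (ℕₚ.<⇒≤ u<m) (ℕₚ.<⇒≤ u<m)
  sq≤ (inj₂ refl) = ℕₚ.≤-refl

  sq≡0 : ∀ u → sq u ≡ 0 → u ≡ + 0
  sq≡0 u eq with ℕₚ.m*n≡0⇒m≡0∨n≡0 ∣ u ∣ eq
  ... | inj₁ e = ℤₚ.∣i∣≡0⇒i≡0 e
  ... | inj₂ e = ℤₚ.∣i∣≡0⇒i≡0 e

  sq< : ∀ {m u} → ∣ u ∣ ℕ.< m → sq u ℕ.< m ℕ.* m
  sq< u<m = ℕₚ.*-mono-< u<m u<m

  completed-square : ∀ t e → t * t + + e ≡ + 4 → ∀ a b →
    + 16 * norm² t a b ≡ + (4 ℕ.* sq (+ 2 * a - t * b) ℕ.+ e ℕ.* sq (+ 2 * b))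
  completed-square t e te≡4 a b = begin
    + 16 * norm² t a b
      ≡⟨ solve 4 (λ t e a b → con (+ 16) :* norm²ᴾ t a b :=
           con (+ 4) :* ((con (+ 2) :* a :- t :* b) :* (con (+ 2) :* a :- t :* b))
           :+ e :* ((con (+ 2) :* b) :* (con (+ 2) :* b))
           :+ con (+ 4) :* (con (+ 4) :- (t :* t :+ e)) :* (b :* b)) refl t (+ e) a b ⟩
    + 4 * (u * u) + + e * (w * w) + + 4 * (+ 4 - (t * t + + e)) * (b * b)
      ≡⟨ cong (λ z → + 4 * (u * u) + + e * (w * w) + + 4 * (+ 4 - z) * (b * b)) te≡4 ⟩
    + 4 * (u * u) + + e * (w * w) + + 0
      ≡⟨ ℤₚ.+-identityʳ _ ⟩
    + 4 * (u * u) + + e * (w * w)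
      ≡⟨ cong₂ (λ y z → + 4 * y + + e * z) (sq-nonneg u) (sq-nonneg w) ⟩
    + 4 * + sq u + + e * + sq w
      ≡⟨ cong₂ _+_ (sym (ℤₚ.pos-* 4 (sq u))) (sym (ℤₚ.pos-* e (sq w))) ⟩
    + (4 ℕ.* sq u ℕ.+ e ℕ.* sq w) ∎
    where
    open ≡-Reasoning
    u w : ℤ
    u = + 2 * a - t * b
    w = + 2 * b

  Reduction : ℤ → ℤ → Quat → Set
  Reduction t m x =
    (∃ λ k → + 0 ℤ.< N t (shift m x k) × N t (shift m x k) ℤ.< m * m)
    ⊎ ∃ λ n → N t x ≡ m * m * n

  Reducible : ℤ → Set
  Reducible t = ∀ m .{{_ : ℕ.NonZero m}} x → Reduction t (+ m) x

  -- The weight e = 4 - t² is the one in 4 (a² - t a b + b²) = (2 a - t b)² + e b².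
  data Weight : ℤ → ℕ → Set where
    lipschitz : Weight (+ 0) 4
    eisenstein : Weight (+ 1) 3

  weight-4 : ∀ {t e} → Weight t e → t * t + + e ≡ + 4
  weight-4 lipschitz = refl
  weight-4 eisenstein = refl

  N-multiple : ∀ t m x k → let open Quat in
    c₀ x ≡ m * c₀ k → c₁ x ≡ m * c₁ k → c₂ x ≡ m * c₂ k → c₃ x ≡ m * c₃ k →
    N t x ≡ m * m * N t k
  N-multiple t m x (quat e f g h) refl refl refl refl = solve 6 (λ t m e f g h →
    Nᴾ t (m :* e) (m :* f) (m :* g) (m :* h) := m :* m :* Nᴾ t e f g h) refl t m e f g h

  -- For t = 0 the reduction x - m k fails to decrease the norm only if all its coordinates are m / 2, but then m² ∣ N x.
  N-half-odd : ∀ m k x → let open Quat in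
    + 2 * c₀ x ≡ m * (+ 1 + + 2 * c₀ k) → + 2 * c₁ x ≡ m * (+ 1 + + 2 * c₁ k) →
    + 2 * c₂ x ≡ m * (+ 1 + + 2 * c₂ k) → + 2 * c₃ x ≡ m * (+ 1 + + 2 * c₃ k) →
    N (+ 0) x ≡ m * m * (+ 1 + (c₀ k + c₁ k + c₂ k + c₃ k) + N (+ 0) k)
  N-half-odd m k@(quat e f g h) (quat a b c d) p q r s = ℤₚ.*-cancelˡ-≡ (+ 4) _ _ (begin
    + 4 * N (+ 0) (quat a b c d)
      ≡⟨ solve 4 (λ a b c d → con (+ 4) :* Nᴾ (con (+ 0)) a b c d :=
        sqᴾ (con (+ 2) :* a) :+ sqᴾ (con (+ 2) :* b) :+ sqᴾ (con (+ 2) :* c) :+ sqᴾ (con (+ 2) :* d)) refl a b c d ⟩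
    (+ 2 * a) * (+ 2 * a) + (+ 2 * b) * (+ 2 * b) + (+ 2 * c) * (+ 2 * c) + (+ 2 * d) * (+ 2 * d)
      ≡⟨ cong₂ _+_ (cong₂ _+_ (cong₂ _+_ (cong₂ _*_ p p) (cong₂ _*_ q q)) (cong₂ _*_ r r)) (cong₂ _*_ s s) ⟩
    _ ≡⟨ solve 5 (λ m e f g h →
        sqᴾ (m :* (con (+ 1) :+ con (+ 2) :* e)) :+ sqᴾ (m :* (con (+ 1) :+ con (+ 2) :* f))
        :+ sqᴾ (m :* (con (+ 1) :+ con (+ 2) :* g)) :+ sqᴾ (m :* (con (+ 1) :+ con (+ 2) :* h))
        := con (+ 4) :* (m :* m :* (con (+ 1) :+ (e :+ f :+ g :+ h) :+ Nᴾ (con (+ 0)) e f g h))) refl m e f g h ⟩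
    + 4 * (m * m * (+ 1 + (e + f + g + h) + N (+ 0) k)) ∎)
    where
    open ≡-Reasoning
    sqᴾ : ∀ {n} → Polynomial n → Polynomial n
    sqᴾ a = a :* a

  sum≡0 : ∀ m n → m ℕ.+ n ≡ 0 → m ≡ 0 × n ≡ 0
  sum≡0 m n eq = ℕₚ.m+n≡0⇒m≡0 m eq , ℕₚ.m+n≡0⇒n≡0 m eq

  double≡0 : ∀ a → + 2 * a ≡ + 0 → a ≡ + 0
  double≡0 a eq = ℤₚ.*-cancelˡ-≡ (+ 2) a (+ 0) eq

  weighted-sum-bound : ∀ {t e} → Weight t e → ∀ m .{{_ : ℕ.NonZero m}} {u w u′ w′} →
    Balanced m u → Balanced m w → Balanced m u′ → Balanced m w′ →
    (4 ℕ.* sq u ℕ.+ e ℕ.* sq w) ℕ.+ (4 ℕ.* sq u′ ℕ.+ e ℕ.* sq w′) ℕ.< 16 ℕ.* (m ℕ.* m)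
    ⊎ t ≡ + 0 × u ≡ + m × w ≡ + m × u′ ≡ + m × w′ ≡ + m
  weighted-sum-bound eisenstein m bu bw bu′ bw′ = inj₁ (ℕₚ.≤-<-trans
    (ℕₚ.+-mono-≤ (ℕₚ.+-mono-≤ (ℕₚ.*-monoʳ-≤ 4 (sq≤ bu)) (ℕₚ.*-monoʳ-≤ 3 (sq≤ bw)))
                 (ℕₚ.+-mono-≤ (ℕₚ.*-monoʳ-≤ 4 (sq≤ bu′)) (ℕₚ.*-monoʳ-≤ 3 (sq≤ bw′))))
    (subst (ℕ._< 16 ℕ.* (m ℕ.* m)) (14M (m ℕ.* m)) (ℕₚ.*-monoˡ-< (m ℕ.* m) {{ℕₚ.m*n≢0 m m}} {14} {16} (ℕₚ.m≤m+n 15 1))))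
    where
    14M : ∀ M → 14 ℕ.* M ≡ (4 ℕ.* M ℕ.+ 3 ℕ.* M) ℕ.+ (4 ℕ.* M ℕ.+ 3 ℕ.* M)
    14M M = trans (ℕₚ.*-distribʳ-+ M 7 7) (cong₂ ℕ._+_ (ℕₚ.*-distribʳ-+ M 4 3) (ℕₚ.*-distribʳ-+ M 4 3))
  weighted-sum-bound lipschitz m {u} {w} {u′} {w′} bu bw bu′ bw′ = go bu bw bu′ bw′
    where
    M = m ℕ.* m
    16M : (4 ℕ.* M ℕ.+ 4 ℕ.* M) ℕ.+ (4 ℕ.* M ℕ.+ 4 ℕ.* M) ≡ 16 ℕ.* M
    16M = sym (trans (ℕₚ.*-distribʳ-+ M 8 8) (cong₂ ℕ._+_ (ℕₚ.*-distribʳ-+ M 4 4) (ℕₚ.*-distribʳ-+ M 4 4)))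
    le : ∀ v → Balanced m v → 4 ℕ.* sq v ℕ.≤ 4 ℕ.* M
    le v b = ℕₚ.*-monoʳ-≤ 4 (sq≤ b)
    lt : ∀ v → ∣ v ∣ ℕ.< m → 4 ℕ.* sq v ℕ.< 4 ℕ.* M
    lt v b = ℕₚ.*-monoʳ-< 4 (sq< {u = v} b)
    lift : ∀ {s} → s ℕ.< (4 ℕ.* M ℕ.+ 4 ℕ.* M) ℕ.+ (4 ℕ.* M ℕ.+ 4 ℕ.* M) → s ℕ.< 16 ℕ.* M
    lift s< = ℕₚ.<-≤-trans s< (ℕₚ.≤-reflexive 16M)
    go : Balanced m u → Balanced m w → Balanced m u′ → Balanced m w′ → _
    go (inj₁ p) _ _ _ = inj₁ (lift (ℕₚ.+-mono-<-≤ (ℕₚ.+-mono-<-≤ (lt u p) (le w bw))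
        (ℕₚ.+-mono-≤ (le u′ bu′) (le w′ bw′))))
    go _ (inj₁ p) _ _ = inj₁ (lift (ℕₚ.+-mono-<-≤ (ℕₚ.+-mono-≤-< (le u bu) (lt w p))
        (ℕₚ.+-mono-≤ (le u′ bu′) (le w′ bw′))))
    go _ _ (inj₁ p) _ = inj₁ (lift (ℕₚ.+-mono-≤-< (ℕₚ.+-mono-≤ (le u bu) (le w bw))
        (ℕₚ.+-mono-<-≤ (lt u′ p) (le w′ bw′))))
    go _ _ _ (inj₁ p) = inj₁ (lift (ℕₚ.+-mono-≤-< (ℕₚ.+-mono-≤ (le u bu) (le w bw))
        (ℕₚ.+-mono-≤-< (le u′ bu′) (lt w′ p))))
    go (inj₂ p) (inj₂ q) (inj₂ r) (inj₂ s) = inj₂ (refl , p , q , r , s)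

  reducible : ∀ {t e} → Weight t e → Reducible t
  reducible {t} {e} wt m x@(quat a b c d) = result
    where
    open ≡-Reasoning
    M : ℤ
    M = + m
    k₁ = balance m (+ 2 * b)
    k₃ = balance m (+ 2 * d)
    k₀ = balance m (+ 2 * a - t * (b - M * proj₁ k₁))
    k₂ = balance m (+ 2 * c - t * (d - M * proj₁ k₃))
    k : Quat
    k = quat (proj₁ k₀) (proj₁ k₁) (proj₁ k₂) (proj₁ k₃)
    A B C D u w u′ w′ : ℤ
    A = a - M * proj₁ k₀
    B = b - M * proj₁ k₁
    C = c - M * proj₁ k₂
    D = d - M * proj₁ k₃
    u = + 2 * A - t * B
    w = + 2 * B
    u′ = + 2 * C - t * D
    w′ = + 2 * D
    pull : ∀ a m k z → + 2 * a - z - + 2 * m * k ≡ + 2 * (a - m * k) - z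
    pull = solve 4 (λ a m k z → con (+ 2) :* a :- z :- con (+ 2) :* m :* k := con (+ 2) :* (a :- m :* k) :- z) refl
    pull₀ : ∀ b m k → + 2 * b - + 2 * m * k ≡ + 2 * (b - m * k)
    pull₀ = solve 3 (λ b m k → con (+ 2) :* b :- con (+ 2) :* m :* k := con (+ 2) :* (b :- m :* k)) refl
    bu : Balanced m u
    bu = subst (Balanced m) (pull a M (proj₁ k₀) (t * B)) (proj₂ k₀)
    bw : Balanced m w
    bw = subst (Balanced m) (pull₀ b M (proj₁ k₁)) (proj₂ k₁)
    bu′ : Balanced m u′
    bu′ = subst (Balanced m) (pull c M (proj₁ k₂) (t * D)) (proj₂ k₂)
    bw′ : Balanced m w′
    bw′ = subst (Balanced m) (pull₀ d M (proj₁ k₃)) (proj₂ k₃)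
    S₁ S₂ : ℕ
    S₁ = 4 ℕ.* sq u ℕ.+ e ℕ.* sq w
    S₂ = 4 ℕ.* sq u′ ℕ.+ e ℕ.* sq w′
    16N : + 16 * N t (shift M x k) ≡ + (S₁ ℕ.+ S₂)
    16N = trans (ℤₚ.*-distribˡ-+ (+ 16) (norm² t A B) (norm² t C D))
      (trans (cong₂ _+_ (completed-square t e (weight-4 wt) A B) (completed-square t e (weight-4 wt) C D))
        (sym (ℤₚ.pos-+ S₁ S₂)))

    e≢0 : Weight t e → ∀ {n} → e ℕ.* n ≡ 0 → n ≡ 0
    e≢0 lipschitz {n} = ℕₚ.m+n≡0⇒m≡0 n
    e≢0 eisenstein {n} = ℕₚ.m+n≡0⇒m≡0 n
    pair≡0 : ∀ A B → 4 ℕ.* sq (+ 2 * A - t * B) ℕ.+ e ℕ.* sq (+ 2 * B) ≡ 0 → A ≡ + 0 × B ≡ + 0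
    pair≡0 A B eq = double≡0 A (trans (trans (sym (ℤₚ.+-identityʳ (+ 2 * A))) (cong (λ z → + 2 * A + - z) (sym tB≡0)))
        (sq≡0 (+ 2 * A - t * B) (ℕₚ.m+n≡0⇒m≡0 _ (proj₁ (sum≡0 (4 ℕ.* sq (+ 2 * A - t * B)) _ eq))))) , B≡0
      where
      B≡0 = double≡0 B (sq≡0 (+ 2 * B) (e≢0 wt (proj₂ (sum≡0 (4 ℕ.* sq (+ 2 * A - t * B)) _ eq))))
      tB≡0 : t * B ≡ + 0
      tB≡0 = trans (cong (t *_) B≡0) (ℤₚ.*-zeroʳ t)

    half : ∀ {m} a k → + 2 * (a - m * k) ≡ m → + 2 * a ≡ m * (+ 1 + + 2 * k)
    half {m} a k eq = trans (solve 3 (λ a m k → con (+ 2) :* a := con (+ 2) :* (a :- m :* k) :+ con (+ 2) :* (m :* k))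
        refl a m k)
      (trans (cong (_+ + 2 * (m * k)) eq) (solve 2 (λ m k → m :+ con (+ 2) :* (m :* k) := m :*
          (con (+ 1) :+ con (+ 2) :* k)) refl m k))
    strip : ∀ {z} A B → t ≡ + 0 → + 2 * A - t * B ≡ z → + 2 * A ≡ z
    strip A B refl eq = trans (solve 2 (λ A B → con (+ 2) :* A := con (+ 2) :* A :- con (+ 0) :* B) refl A B) eq

    result : Reduction t (+ m) x
    result with S₁ ℕ.+ S₂ in S≡
    ... | zero with p , q ← sum≡0 S₁ S₂ S≡ with A≡0 , B≡0 ← pair≡0 A B p | C≡0 , D≡0 ← pair≡0 C D q =
      inj₂ (N t k , N-multiple t M x k (ℤₚ.i-j≡0⇒i≡j a _ A≡0) (ℤₚ.i-j≡0⇒i≡j b _ B≡0)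
                                   (ℤₚ.i-j≡0⇒i≡j c _ C≡0) (ℤₚ.i-j≡0⇒i≡j d _ D≡0))
    ... | suc S with weighted-sum-bound wt m bu bw bu′ bw′
    ...   | inj₁ S<16M = inj₁ (k
            , ℤₚ.*-cancelˡ-<-nonNeg (+ 16) (subst (+ 0 ℤ.<_) (sym (trans 16N (cong +_ S≡))) (+<+ (s≤s z≤n)))
            , ℤₚ.*-cancelˡ-<-nonNeg (+ 16) (subst₂ ℤ._<_ (sym 16N)
                (trans (ℤₚ.pos-* 16 (m ℕ.* m)) (cong (+ 16 *_) (ℤₚ.pos-* m m))) (+<+ S<16M)))
    ...   | inj₂ (t≡0 , u≡ , w≡ , u′≡ , w′≡) = inj₂ (_ ,
            trans (cong (λ t → N t x) t≡0)
              (N-half-odd M k x (half a _ (strip A B t≡0 u≡)) (half b _ w≡) (half c _ (strip C D t≡0 u′≡))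
                  (half d _ w′≡)))

  proper-∤ : ∀ {p m} → Prime p → 1 ℕ.< m → m ℕ.< p → ¬ m ℕᵈ.∣ p
  proper-∤ pp 1<m m<p m∣p with prime⇒irreducible pp m∣p
  ... | inj₁ refl = ℕₚ.<-irrefl refl 1<m
  ... | inj₂ refl = ℕₚ.<-irrefl refl m<p

  descend : ∀ {t e} → Weight t e → ∀ {p} → Prime p → ∀ m → Acc ℕ._<_ m → 0 ℕ.< m → m ℕ.< p →
    ∀ x → N t x ≡ + m * + p → Represented t (+ p)
  descend wt pp (suc zero) _ _ _ x Nx≡ = x , trans Nx≡ (ℤₚ.*-identityˡ _)
  descend {t} wt {p} pp m@(suc (suc _)) (acc rec) _ m<p x Nx≡ with reducible wt m x
  ... | inj₂ (n , Nx≡mmn) = contradiction m∣p (proper-∤ pp (s≤s (s≤s z≤n)) m<p)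
    where
    p≡mn : + p ≡ + m * n
    p≡mn = ℤₚ.*-cancelˡ-≡ (+ m) _ _ (trans (sym Nx≡) (trans Nx≡mmn (ℤₚ.*-assoc (+ m) (+ m) n)))
    m∣p : m ℕᵈ.∣ p
    m∣p = ℕᵈ.divides ∣ n ∣ (trans (cong ∣_∣ p≡mn) (trans (ℤₚ.abs-* (+ m) n) (ℕₚ.*-comm m ∣ n ∣)))
  ... | inj₁ (k , 0<N , N<mm) = descend wt pp ∣ q ∣ (rec ∣q∣<m) 0<∣q∣ (ℕₚ.<-trans ∣q∣<m m<p) (cofactor t (+ p) x k) eq
    where
    q : ℤ
    q = + p - polar t x k + + m * N t k
    N≡mq : N t (shift (+ m) x k) ≡ + m * q
    N≡mq = trans (N-shift t (+ m) x k) (trans (cong (λ z → z - + m * polar t x k + + m * + m * N t k) Nx≡)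
      (solve 4 (λ m p T n → m :* p :- m :* T :+ m :* m :* n := m :* (p :- T :+ m :* n)) refl (+ m) (+ p) (polar t x k)
          (N t k)))
    0<q : + 0 ℤ.< q
    0<q = ℤₚ.*-cancelˡ-<-nonNeg (+ m) (subst₂ ℤ._<_ (sym (ℤₚ.*-zeroʳ (+ m))) N≡mq 0<N)
    ∣q∣≡q : + ∣ q ∣ ≡ q
    ∣q∣≡q = ℤₚ.0≤i⇒+∣i∣≡i (ℤₚ.<⇒≤ 0<q)
    0<∣q∣ : 0 ℕ.< ∣ q ∣
    0<∣q∣ = ℤₚ.drop‿+<+ (subst (+ 0 ℤ.<_) (sym ∣q∣≡q) 0<q)
    ∣q∣<m : ∣ q ∣ ℕ.< m
    ∣q∣<m = ℤₚ.drop‿+<+ (subst (ℤ._< + m) (sym ∣q∣≡q) (ℤₚ.*-cancelˡ-<-nonNeg (+ m) (subst (ℤ._< + m * + m) N≡mq N<mm)))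
    eq : N t (cofactor t (+ p) x k) ≡ + ∣ q ∣ * + p
    eq = trans (N-cofactor t (+ p) x k) (trans (cong (λ z → + p * + p - + p * polar t x k + z * N t k) Nx≡)
      (trans (solve 4 (λ m p T n → p :* p :- p :* T :+ m :* p :* n := (p :- T :+ m :* n) :* p) refl (+ m) (+ p)
          (polar t x k) (N t k))
        (cong (_* + p) (sym ∣q∣≡q))))

  %ℕ-≡⇒∣- : ∀ p .{{_ : ℕ.NonZero p}} i j → i %ℕ p ≡ j %ℕ p → ∃ λ k → i - j ≡ k * + p
  %ℕ-≡⇒∣- p i j eq = i /ℕ p - j /ℕ p , (begin
    i - j ≡⟨ cong₂ _-_ (a≡a%ℕn+[a/ℕn]*n i p) (a≡a%ℕn+[a/ℕn]*n j p) ⟩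
    (+ (i %ℕ p) + i /ℕ p * + p) - (+ (j %ℕ p) + j /ℕ p * + p) ≡⟨ cong
        (λ r → (+ r + i /ℕ p * + p) - (+ (j %ℕ p) + j /ℕ p * + p)) eq ⟩
    (+ (j %ℕ p) + i /ℕ p * + p) - (+ (j %ℕ p) + j /ℕ p * + p)
      ≡⟨ solve 4 (λ r u v p → (r :+ u :* p) :- (r :+ v :* p) := (u :- v) :* p) refl (+ (j %ℕ p)) (i /ℕ p) (j /ℕ p)
          (+ p) ⟩
    (i /ℕ p - j /ℕ p) * + p ∎)
    where open ≡-Reasoning

  ∣abs : ∀ {p i k} → i ≡ k * + p → p ℕᵈ.∣ ∣ i ∣
  ∣abs {p} {k = k} refl = ℕᵈ.divides ∣ k ∣ (ℤₚ.abs-* k (+ p))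

  euclidℤ : ∀ {p} → Prime p → ∀ i j → p ℕᵈ.∣ ∣ i * j ∣ → p ℕᵈ.∣ ∣ i ∣ ⊎ p ℕᵈ.∣ ∣ j ∣
  euclidℤ {p} pp i j d = euclidsLemma ∣ i ∣ ∣ j ∣ pp (subst (p ℕᵈ.∣_) (ℤₚ.abs-* i j) d)

  ∣⇒≡0 : ∀ {p n} → p ℕᵈ.∣ n → n ℕ.< p → n ≡ 0
  ∣⇒≡0 {n = zero} _ _ = refl
  ∣⇒≡0 {n = suc n} d n<p = contradiction (ℕᵈ.∣⇒≤ d) (ℕₚ.<⇒≱ n<p)

  squares-distinct : ∀ {p h} → Prime p → h ℕ.+ h ℕ.< p → ∀ {y z} → y ℕ.≤ h → z ℕ.≤ h →
    p ℕᵈ.∣ ∣ + y * + y - + z * + z ∣ → y ≡ z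
  squares-distinct {p} {h} pp 2h<p {y} {z} y≤h z≤h d
    with euclidℤ pp (+ y - + z) (+ y + + z) (subst (λ i → p ℕᵈ.∣ ∣ i ∣)
           (solve 2 (λ y z → y :* y :- z :* z := (y :- z) :* (y :+ z)) refl (+ y) (+ z)) d)
  ... | inj₁ p∣- = ℤₚ.+-injective (ℤₚ.i-j≡0⇒i≡j (+ y) (+ z) (ℤₚ.∣i∣≡0⇒i≡0 (∣⇒≡0 p∣-
          (ℕₚ.≤-<-trans (ℕₚ.≤-trans (ℤₚ.∣i-j∣≤∣i∣+∣j∣ (+ y) (+ z)) (ℕₚ.+-mono-≤ y≤h z≤h)) 2h<p))))
  ... | inj₂ p∣+ with y+z≡0 ← ∣⇒≡0 p∣+ (ℕₚ.≤-<-trans (ℕₚ.+-mono-≤ y≤h z≤h) 2h<p) =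
    trans (ℕₚ.m+n≡0⇒m≡0 y y+z≡0) (sym (ℕₚ.m+n≡0⇒n≡0 y y+z≡0))

  solution-mod : ∀ {p h} → Prime p → p ≡ suc (h ℕ.+ h) → ∀ e → ¬ p ℕᵈ.∣ e →
    ∃₂ λ y z → y ℕ.≤ h × z ℕ.≤ h × ∃ λ k → + 1 + + e * (+ y * + y) + + z * + z ≡ k * + p
  solution-mod {p} {h} pp refl e p∤e = result
    where
    instance _ = prime⇒nonZero pp
    value : Fin (suc h) ⊎ Fin (suc h) → ℤ
    value (inj₁ z) = + toℕ z * + toℕ z
    value (inj₂ y) = - (+ 1 + + e * (+ toℕ y * + toℕ y))
    residue : Fin (suc h ℕ.+ suc h) → Fin p
    residue i = fromℕ< (n%ℕd<d (value (splitAt (suc h) i)) p)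
    below : ∀ (i : Fin (suc h)) → toℕ i ℕ.≤ h
    below i = ℕₚ.≤-pred (Finₚ.toℕ<n i)
    Result : Set
    Result = ∃₂ λ y z → y ℕ.≤ h × z ℕ.≤ h × ∃ λ k → + 1 + + e * (+ y * + y) + + z * + z ≡ k * + p
    distinct : ∀ y z → p ℕᵈ.∣ ∣ + toℕ y * + toℕ y - + toℕ z * + toℕ z ∣ → y ≡ z
    distinct y z d = Finₚ.toℕ-injective (squares-distinct {h = h} pp (ℕₚ.n<1+n _) (below y) (below z) d)
    mixed : ∀ y z → (∃ λ k → value (inj₁ z) - value (inj₂ y) ≡ k * + p) → Result
    mixed y z (k , eq) = toℕ y , toℕ z , below y , below z , k ,
      trans (solve 3 (λ e y z → con (+ 1) :+ e :* y :+ z := z :- (:- (con (+ 1) :+ e :* y))) refl (+ e)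
          (+ toℕ y * + toℕ y) (+ toℕ z * + toℕ z)) eq
    analyse : ∀ a b → a ≢ b → (∃ λ k → value a - value b ≡ k * + p) → Result
    analyse (inj₁ z) (inj₁ z′) a≢b (k , eq) = contradiction (cong inj₁ (distinct z z′ (∣abs {k = k} eq))) a≢b
    analyse (inj₁ z) (inj₂ y) _ k = mixed y z k
    analyse (inj₂ y) (inj₁ z) _ (k , eq) = mixed y z (- k , (begin
      value (inj₁ z) - value (inj₂ y) ≡⟨ solve 2 (λ a b → a :- b := :- (b :- a)) refl (value (inj₁ z)) (value (inj₂ y))
          ⟩
      - (value (inj₂ y) - value (inj₁ z)) ≡⟨ cong -_ eq ⟩
      - (k * + p) ≡⟨ ℤₚ.neg-distribˡ-* k (+ p) ⟩
      - k * + p ∎))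
      where open ≡-Reasoning
    analyse (inj₂ y) (inj₂ y′) a≢b (k , eq)
      with euclidℤ pp (+ e) (+ toℕ y′ * + toℕ y′ - + toℕ y * + toℕ y) (subst (λ i → p ℕᵈ.∣ ∣ i ∣)
        (solve 3 (λ e y y′ → :- (con (+ 1) :+ e :* y) :- (:- (con (+ 1) :+ e :* y′)) := e :* (y′ :- y)) refl (+ e)
            (+ toℕ y * + toℕ y) (+ toℕ y′ * + toℕ y′))
        (∣abs {k = k} eq))
    ... | inj₁ p∣e = contradiction p∣e p∤e
    ... | inj₂ d = contradiction (cong inj₂ (sym (distinct y′ y d))) a≢b
    result : Result
    result with i , j , i<j , eq ← Finₚ.pigeonhole (s≤s (ℕₚ.+-monoʳ-< h (ℕₚ.n<1+n h))) residue =
      analyse (splitAt (suc h) i) (splitAt (suc h) j)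
        (λ s≡ → Finₚ.<⇒≢ i<j (trans (sym (Finₚ.join-splitAt (suc h) (suc h) i))
            (trans (cong (Fin.join (suc h) (suc h)) s≡) (Finₚ.join-splitAt (suc h) (suc h) j))))
        (%ℕ-≡⇒∣- p (value (splitAt (suc h) i)) (value (splitAt (suc h) j)) (Finₚ.fromℕ<-injective _ _ _ _ eq))

  Seed : ℤ → ℕ → Set
  Seed t p = ∃ λ m → 0 ℕ.< m × m ℕ.< p × ∃ λ x → N t x ≡ + m * + p

  module _ (t : ℤ) (e : ℕ) (e≤3 : e ℕ.≤ 3)
           (embed : ∀ y z → ∃ λ x → N t x ≡ + 1 + + e * (+ y * + y) + + z * + z) where

    odd-seed : ∀ {p h} → Prime p → p ≡ suc (suc h ℕ.+ suc h) → ¬ p ℕᵈ.∣ e → Seed t p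
    odd-seed {p} {h-1} pp p≡ p∤e with y , z , y≤h , z≤h , k , eq ← solution-mod {h = suc h-1} pp p≡ e p∤e =
      ∣ k ∣ , 0<m , m<p , proj₁ (embed y z) , trans (proj₂ (embed y z))
          (trans Vℤ (trans (cong +_ V≡) (ℤₚ.pos-* ∣ k ∣ p)))
      where
      h = suc h-1
      V : ℕ
      V = suc (e ℕ.* (y ℕ.* y) ℕ.+ z ℕ.* z)
      Vℤ : + 1 + + e * (+ y * + y) + + z * + z ≡ + V
      Vℤ = sym (trans (ℤₚ.pos-+ (suc (e ℕ.* (y ℕ.* y))) (z ℕ.* z)) (cong₂ _+_ (trans (ℤₚ.pos-+ 1 (e ℕ.* (y ℕ.* y)))
        (cong (λ i → + 1 + i) (trans (ℤₚ.pos-* e (y ℕ.* y)) (cong (λ i → + e * i) (ℤₚ.pos-* y y))))) (ℤₚ.pos-* z z)))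
      V≡ : V ≡ ∣ k ∣ ℕ.* p
      V≡ = trans (cong ∣_∣ (trans (sym Vℤ) eq)) (ℤₚ.abs-* k (+ p))
      0<m : 0 ℕ.< ∣ k ∣
      0<m with ∣ k ∣ | V≡
      ... | suc _ | _ = s≤s z≤n
      V<pp : V ℕ.< p ℕ.* p
      V<pp = begin-strict
        suc (e ℕ.* (y ℕ.* y) ℕ.+ z ℕ.* z) ≤⟨ s≤s (ℕₚ.+-mono-≤ (ℕₚ.*-mono-≤ e≤3 (ℕₚ.*-mono-≤ y≤h y≤h))
            (ℕₚ.*-mono-≤ z≤h z≤h)) ⟩
        suc (3 ℕ.* (h ℕ.* h) ℕ.+ h ℕ.* h) <⟨ s≤s (ℕₚ.m<m+n (3 ℕ.* (h ℕ.* h) ℕ.+ h ℕ.* h) {4 ℕ.* h} (s≤s z≤n)) ⟩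
        suc (3 ℕ.* (h ℕ.* h) ℕ.+ h ℕ.* h ℕ.+ 4 ℕ.* h) ≡⟨ ℕ-solve 1
            (λ h → ℕ-con 1 ⊕ (ℕ-con 3 ⊗ (h ⊗ h) ⊕ h ⊗ h ⊕ ℕ-con 4 ⊗ h) ⊜ (ℕ-con 1 ⊕ (h ⊕ h)) ⊗ (ℕ-con 1 ⊕ (h ⊕ h)))
            refl h ⟩
        suc (h ℕ.+ h) ℕ.* suc (h ℕ.+ h) ≡⟨ cong₂ ℕ._*_ (sym p≡) (sym p≡) ⟩
        p ℕ.* p ∎
        where
        open ℕₚ.≤-Reasoning

        open ℕ-Solver using () renaming (solve to ℕ-solve; con to ℕ-con; _:+_ to _⊕_; _:*_ to _⊗_; _:=_ to _⊜_)
      m<p : ∣ k ∣ ℕ.< p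
      m<p = ℕₚ.*-cancelʳ-< p ∣ k ∣ p (subst (ℕ._< p ℕ.* p) V≡ V<pp)

  parity : ∀ n → ∃ λ h → n ≡ h ℕ.+ h ⊎ n ≡ suc (h ℕ.+ h)
  parity zero = 0 , inj₁ refl
  parity (suc n) with parity n
  ... | h , inj₁ refl = h , inj₂ refl
  ... | h , inj₂ refl = suc h , inj₁ (cong suc (sym (ℕₚ.+-suc h h)))

  prime-∤ : ∀ {p q} → Prime p → Prime q → p ≢ q → ¬ p ℕᵈ.∣ q
  prime-∤ pp pq p≢q p∣q with prime⇒irreducible pq p∣q
  ... | inj₁ refl = contradiction pp ¬prime[1]
  ... | inj₂ p≡q = p≢q p≡q

  seed : ∀ {t e} → Weight t e → ∀ {p} → Prime p → Seed t p
  seed {t} wt {p} pp with parity p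
  ... | h , inj₁ p≡ with prime⇒irreducible pp (ℕᵈ.divides {2} h
      (trans p≡ (sym (trans (ℕₚ.*-comm h 2) (cong (h ℕ.+_) (ℕₚ.+-identityʳ h))))))
  ...   | inj₂ refl = 1 , s≤s z≤n , s≤s (s≤s z≤n) , quat (+ 1) (+ 0) (+ 1) (+ 0) , two wt
    where
    two : ∀ {t e} → Weight t e → N t (quat (+ 1) (+ 0) (+ 1) (+ 0)) ≡ + 1 * + 2
    two lipschitz = refl
    two eisenstein = refl
  seed wt pp | zero , inj₂ refl = contradiction pp ¬prime[1]
  seed lipschitz pp | suc h , inj₂ p≡ = odd-seed (+ 0) 1 (s≤s z≤n)
    (λ y z → quat (+ 1) (+ y) (+ z) (+ 0) ,
      solve 2 (λ y z → Nᴾ (con (+ 0)) (con (+ 1)) y z (con (+ 0)) := con (+ 1) :+ con (+ 1) :* (y :* y) :+ z :* z) refl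
          (+ y) (+ z))
    pp p≡ λ p∣1 → ¬prime[1] (subst Prime (ℕᵈ.∣1⇒≡1 p∣1) pp)
  seed eisenstein {p} pp | suc h , inj₂ p≡ with p ℕ.≟ 3
  ... | yes refl = 1 , s≤s z≤n , s≤s (s≤s z≤n) , quat (+ 1) (-[1+ 0 ]) (+ 0) (+ 0) , refl
  ... | no p≢3 = odd-seed (+ 1) 3 ℕₚ.≤-refl
    (λ y z → quat (+ 1 + + y) (+ 2 * + y) (+ z) (+ 0) ,
      solve 2 (λ y z → Nᴾ (con (+ 1)) (con (+ 1) :+ y) (con (+ 2) :* y) z (con (+ 0)) := con (+ 1) :+ con (+ 3) :*
          (y :* y) :+ z :* z) refl (+ y) (+ z))
    pp p≡ (prime-∤ pp prime[3] p≢3)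
    where
    prime[3] : Prime 3
    prime[3] = from-yes (prime? 3)

  prime-represented : ∀ {t e} → Weight t e → ∀ {p} → Prime p → Represented t (+ p)
  prime-represented wt pp with m , 0<m , m<p , x , eq ← seed wt pp = descend wt pp m (<-wellFounded m) 0<m m<p x eq

  universal : ∀ {t e} → Weight t e → ∀ n → 1 ℕ.≤ n → Represented t (+ n)
  universal {t} wt n@(suc _) _ = subst (λ n → Represented t (+ n)) (sym isFactorisation) (products factorsPrime)
    where
    open PrimeFactorisation (factorise n)
    one : ∀ {t e} → Weight t e → Represented t (+ 1)
    one lipschitz = quat (+ 1) (+ 0) (+ 0) (+ 0) , refl
    one eisenstein = quat (+ 1) (+ 0) (+ 0) (+ 0) , refl
    products : ∀ {ps} → All Prime ps → Represented t (+ product ps)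
    products [] = one wt
    products {p ∷ ps} (pp ∷ pps) = subst (Represented t) (sym (ℤₚ.pos-* p (product ps)))
      (represented-* t (prime-represented wt pp) (products pps))

open UniversalForms using (Quat; quat; norm²; N; Weight; lipschitz; eisenstein; universal)

ι : ℤ → ℚ
ι z = z ℚ./ 1

toℚᵘ-ι : ∀ z → toℚᵘ (ι z) ℚᵘ.≃ ℚᵘ.mkℚᵘ z 0
toℚᵘ-ι z = ℚₚ.toℚᵘ-fromℚᵘ (ℚᵘ.mkℚᵘ z 0)

ι-+ : ∀ i j → ι (i ℤ.+ j) ≡ ι i ℚ.+ ι j
ι-+ i j = ℚₚ.toℚᵘ-injective (begin
  toℚᵘ (ι (i ℤ.+ j)) ≈⟨ toℚᵘ-ι (i ℤ.+ j) ⟩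
  ℚᵘ.mkℚᵘ (i ℤ.+ j) 0 ≈⟨ ℚᵘ.*≡* (solve 2 (λ i j → (i :+ j) :* con (+ 1) := (i :* con (+ 1) :+ j :* con (+ 1)) :* con
      (+ 1)) refl i j) ⟩
  ℚᵘ.mkℚᵘ i 0 ℚᵘ.+ ℚᵘ.mkℚᵘ j 0 ≈⟨ ℚᵘₚ.+-cong (toℚᵘ-ι i) (toℚᵘ-ι j) ⟨
  toℚᵘ (ι i) ℚᵘ.+ toℚᵘ (ι j) ≈⟨ ℚₚ.toℚᵘ-homo-+ (ι i) (ι j) ⟨
  toℚᵘ (ι i ℚ.+ ι j) ∎)
  where open ℚᵘₚ.≃-Reasoning
        open ℤ-Solver

ι-* : ∀ i j → ι (i ℤ.* j) ≡ ι i ℚ.* ι j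
ι-* i j = ℚₚ.toℚᵘ-injective (begin
  toℚᵘ (ι (i ℤ.* j)) ≈⟨ toℚᵘ-ι (i ℤ.* j) ⟩
  ℚᵘ.mkℚᵘ i 0 ℚᵘ.* ℚᵘ.mkℚᵘ j 0 ≈⟨ ℚᵘₚ.*-cong (toℚᵘ-ι i) (toℚᵘ-ι j) ⟨
  toℚᵘ (ι i) ℚᵘ.* toℚᵘ (ι j) ≈⟨ ℚₚ.toℚᵘ-homo-* (ι i) (ι j) ⟨
  toℚᵘ (ι i ℚ.* ι j) ∎)
  where open ℚᵘₚ.≃-Reasoning

ι-neg : ∀ i → ι (ℤ.- i) ≡ ℚ.- ι i
ι-neg i = ℚₚ.toℚᵘ-injective (begin
  toℚᵘ (ι (ℤ.- i)) ≈⟨ toℚᵘ-ι (ℤ.- i) ⟩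
  ℚᵘ.- ℚᵘ.mkℚᵘ i 0 ≈⟨ ℚᵘₚ.-‿cong (toℚᵘ-ι i) ⟨
  ℚᵘ.- toℚᵘ (ι i) ≈⟨ ℚₚ.toℚᵘ-homo‿- (ι i) ⟨
  toℚᵘ (ℚ.- ι i) ∎)
  where open ℚᵘₚ.≃-Reasoning

ι-- : ∀ i j → ι (i ℤ.- j) ≡ ι i ℚ.- ι j
ι-- i j = trans (ι-+ i (ℤ.- j)) (cong (λ q → ι i ℚ.+ q) (ι-neg j))

module Summation (R : Semiring 0ℓ 0ℓ)
  (∑ : ∀ {n} → (Fin n → Semiring.Carrier R) → Semiring.Carrier R)
  (∑-sum : ∀ {n} f → Semiring._≈_ R (∑ {n} f) (SemiringSum.sum R f)) where

  open Semiring R renaming (sym to ≈-sym; trans to ≈-trans) hiding (refl)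
  open import Relation.Binary.Reasoning.Setoid setoid
  private module Sums = SemiringSum R

  ∑-cong : ∀ {n} {f g : Fin n → Carrier} → (∀ i → f i ≈ g i) → ∑ f ≈ ∑ g
  ∑-cong {f = f} {g} f≈g = ≈-trans (∑-sum f) (≈-trans (Sums.sum-cong-≋ f≈g) (≈-sym (∑-sum g)))

  ∑-+ : ∀ {n} (f g : Fin n → Carrier) → ∑ (λ i → f i + g i) ≈ ∑ f + ∑ g
  ∑-+ f g = ≈-trans (∑-sum _) (≈-trans (Sums.∑-distrib-+ f g) (≈-sym (+-cong (∑-sum f) (∑-sum g))))

  ∑-*ˡ : ∀ {n} x (f : Fin n → Carrier) → ∑ (λ i → x * f i) ≈ x * ∑ f
  ∑-*ˡ x f = ≈-trans (∑-sum _) (≈-trans (≈-sym (Sums.*-distribˡ-sum x f)) (*-congˡ (≈-sym (∑-sum f))))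

  ∑-*ʳ : ∀ {n} x (f : Fin n → Carrier) → ∑ (λ i → f i * x) ≈ ∑ f * x
  ∑-*ʳ x f = ≈-trans (∑-sum _) (≈-trans (≈-sym (Sums.*-distribʳ-sum x f)) (*-congʳ (≈-sym (∑-sum f))))

  ∑-comm : ∀ {m n} (f : Fin m → Fin n → Carrier) → ∑ (λ i → ∑ (f i)) ≈ ∑ (λ j → ∑ (λ i → f i j))
  ∑-comm f = begin
    ∑ (λ i → ∑ (f i)) ≈⟨ ∑-cong (λ i → ∑-sum (f i)) ⟩
    ∑ (λ i → Sums.sum (f i)) ≈⟨ ∑-sum _ ⟩
    Sums.sum (λ i → Sums.sum (f i)) ≈⟨ Sums.∑-comm f ⟩
    Sums.sum (λ j → Sums.sum (λ i → f i j)) ≈⟨ ∑-sum _ ⟨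
    ∑ (λ j → Sums.sum (λ i → f i j)) ≈⟨ ∑-cong (λ j → ∑-sum (λ i → f i j)) ⟨
    ∑ (λ j → ∑ (λ i → f i j)) ∎

  ∑-involution : ∀ {n} (π : Fin n → Fin n) → (∀ i → π (π i) ≡ i) → ∀ f → ∑ f ≈ ∑ (f ∘ π)
  ∑-involution π ππ f = ≈-trans (∑-sum f) (≈-trans (Sums.sum-permute f perm) (≈-sym (∑-sum (f ∘ π))))
    where
    perm : Permutation _ _
    perm = permutation π π ππ ππ

∑ℚ≡sum : ∀ {n} (f : Fin n → ℚ) → ∑ℚ f ≡ SemiringSum.sum (CommutativeRing.semiring ℚₚ.+-*-commutativeRing) f
∑ℚ≡sum {zero} f = refl
∑ℚ≡sum {suc n} f = cong (λ q → f zero ℚ.+ q) (∑ℚ≡sum (f ∘ suc))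

∑ℤ≡sum : ∀ {n} (f : Fin n → ℤ) → ∑ℤ f ≡ SemiringSum.sum (CommutativeRing.semiring ℤₚ.+-*-commutativeRing) f
∑ℤ≡sum {zero} f = refl
∑ℤ≡sum {suc n} f = cong (λ q → f zero ℤ.+ q) (∑ℤ≡sum (f ∘ suc))

module ∑ℚ = Summation (CommutativeRing.semiring ℚₚ.+-*-commutativeRing) ∑ℚ ∑ℚ≡sum
module ∑ℤ = Summation (CommutativeRing.semiring ℤₚ.+-*-commutativeRing) ∑ℤ ∑ℤ≡sum

∑ℚ-zero : ∀ n → ∑ℚ {n} (λ _ → 0ℚ) ≡ 0ℚ
∑ℚ-zero zero = refl
∑ℚ-zero (suc n) = trans (ℚₚ.+-identityˡ _) (∑ℚ-zero n)

∑ℚ-supported : ∀ {n} (f : Fin n → ℚ) p → (∀ j → j ≢ p → f j ≡ 0ℚ) → ∑ℚ f ≡ f p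
∑ℚ-supported {suc n} f zero off = trans (cong (f zero ℚ.+_)
  (trans (∑ℚ.∑-cong (λ j → off (suc j) λ ())) (∑ℚ-zero n))) (ℚₚ.+-identityʳ _)
∑ℚ-supported {suc n} f (suc p) off = trans (cong₂ ℚ._+_ (off zero λ ())
    (∑ℚ-supported (f ∘ suc) p (λ j j≢p → off (suc j) (j≢p ∘ Finₚ.suc-injective))))
  (ℚₚ.+-identityˡ _)

Identity : ∀ {n} → Mat n
Identity i j = if does (j ≟ i) then 1ℚ else 0ℚ

_∙_ : ∀ {n} → Mat n → Mat n → Mat n
(A ∙ B) i j = ∑ℚ (λ k → A i k ℚ.* B k j)

apply-monomial : ∀ {n} (π : Fin n → Fin n) (s : Fin n → ℚ) x i →
  apply (λ i j → if does (j ≟ π i) then s i else 0ℚ) x i ≡ s i ℚ.* x (π i)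
apply-monomial π s x i = trans (∑ℚ-supported _ (π i) off) on
  where
  off : ∀ j → j ≢ π i → (if does (j ≟ π i) then s i else 0ℚ) ℚ.* x j ≡ 0ℚ
  off j j≢ with j ≟ π i
  ... | yes eq = contradiction eq j≢
  ... | no _ = ℚₚ.*-zeroˡ (x j)
  on : (if does (π i ≟ π i) then s i else 0ℚ) ℚ.* x (π i) ≡ s i ℚ.* x (π i)
  on with π i ≟ π i
  ... | yes _ = refl
  ... | no neq = contradiction refl neq

apply-Identity : ∀ {n} (x : Vecℚ n) i → apply Identity x i ≡ x i
apply-Identity x i = trans (apply-monomial (λ i → i) (λ _ → 1ℚ) x i) (ℚₚ.*-identityˡ (x i))

apply-cong : ∀ {n} (A : Mat n) {x y : Vecℚ n} → (∀ i → x i ≡ y i) → ∀ i → apply A x i ≡ apply A y i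
apply-cong A x≗y i = ∑ℚ.∑-cong (λ j → cong (A i j ℚ.*_) (x≗y j))

apply-∙ : ∀ {n} (A B : Mat n) x i → apply (A ∙ B) x i ≡ apply A (apply B x) i
apply-∙ A B x i = begin
  ∑ℚ (λ j → ∑ℚ (λ k → A i k ℚ.* B k j) ℚ.* x j)
    ≡⟨ ∑ℚ.∑-cong (λ j → ∑ℚ.∑-*ʳ (x j) (λ k → A i k ℚ.* B k j)) ⟨
  ∑ℚ (λ j → ∑ℚ (λ k → A i k ℚ.* B k j ℚ.* x j))
    ≡⟨ ∑ℚ.∑-comm (λ j k → A i k ℚ.* B k j ℚ.* x j) ⟩
  ∑ℚ (λ k → ∑ℚ (λ j → A i k ℚ.* B k j ℚ.* x j))
    ≡⟨ ∑ℚ.∑-cong (λ k → trans (∑ℚ.∑-cong (λ j → ℚₚ.*-assoc (A i k) (B k j) (x j)))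
        (∑ℚ.∑-*ˡ (A i k) (λ j → B k j ℚ.* x j))) ⟩
  ∑ℚ (λ k → A i k ℚ.* apply B x k) ∎
  where open ≡-Reasoning

apply-linear : ∀ {n} a b c d (A B C D : Mat n) x i →
  apply (λ i j → a ℚ.* A i j ℚ.+ b ℚ.* B i j ℚ.+ c ℚ.* C i j ℚ.+ d ℚ.* D i j) x i
  ≡ a ℚ.* apply A x i ℚ.+ b ℚ.* apply B x i ℚ.+ c ℚ.* apply C x i ℚ.+ d ℚ.* apply D x i
apply-linear a b c d A B C D x i = begin
  ∑ℚ (λ j → (a ℚ.* A i j ℚ.+ b ℚ.* B i j ℚ.+ c ℚ.* C i j ℚ.+ d ℚ.* D i j) ℚ.* x j)
    ≡⟨ ∑ℚ.∑-cong (λ j → spread a b c d (A i j) (B i j) (C i j) (D i j) (x j)) ⟩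
  ∑ℚ (λ j → a ℚ.* (A i j ℚ.* x j) ℚ.+ b ℚ.* (B i j ℚ.* x j) ℚ.+ c ℚ.* (C i j ℚ.* x j) ℚ.+ d ℚ.* (D i j ℚ.* x j))
    ≡⟨ ∑ℚ.∑-+ (λ j → fa j ℚ.+ fb j ℚ.+ fc j) fd ⟩
  ∑ℚ (λ j → fa j ℚ.+ fb j ℚ.+ fc j) ℚ.+ ∑ℚ fd
    ≡⟨ cong (ℚ._+ ∑ℚ fd) (trans (∑ℚ.∑-+ (λ j → fa j ℚ.+ fb j) fc) (cong (ℚ._+ ∑ℚ fc) (∑ℚ.∑-+ fa fb))) ⟩
  ∑ℚ fa ℚ.+ ∑ℚ fb ℚ.+ ∑ℚ fc ℚ.+ ∑ℚ fd
    ≡⟨ cong₂ ℚ._+_ (cong₂ ℚ._+_ (cong₂ ℚ._+_ (∑ℚ.∑-*ˡ a (λ j → A i j ℚ.* x j)) (∑ℚ.∑-*ˡ b (λ j → B i j ℚ.* x j)))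
         (∑ℚ.∑-*ˡ c (λ j → C i j ℚ.* x j))) (∑ℚ.∑-*ˡ d (λ j → D i j ℚ.* x j)) ⟩
  a ℚ.* apply A x i ℚ.+ b ℚ.* apply B x i ℚ.+ c ℚ.* apply C x i ℚ.+ d ℚ.* apply D x i ∎
  where
  fa fb fc fd : Fin _ → ℚ
  fa j = a ℚ.* (A i j ℚ.* x j)
  fb j = b ℚ.* (B i j ℚ.* x j)
  fc j = c ℚ.* (C i j ℚ.* x j)
  fd j = d ℚ.* (D i j ℚ.* x j)
  open ≡-Reasoning
  open ℚ-Solver
  spread : ∀ a b c d p q r s x → (a ℚ.* p ℚ.+ b ℚ.* q ℚ.+ c ℚ.* r ℚ.+ d ℚ.* s) ℚ.* x
    ≡ a ℚ.* (p ℚ.* x) ℚ.+ b ℚ.* (q ℚ.* x) ℚ.+ c ℚ.* (r ℚ.* x) ℚ.+ d ℚ.* (s ℚ.* x)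
  spread = solve 9 (λ a b c d p q r s x → (a :* p :+ b :* q :+ c :* r :+ d :* s) :* x
    := a :* (p :* x) :+ b :* (q :* x) :+ c :* (r :* x) :+ d :* (s :* x)) refl

infixl 7 _⊙_
infixl 6 _⊕_

_⊕_ : ∀ {n} → Vecℚ n → Vecℚ n → Vecℚ n
(x ⊕ y) i = x i ℚ.+ y i

_⊙_ : ∀ {n} → ℚ → Vecℚ n → Vecℚ n
(a ⊙ x) i = a ℚ.* x i

record Bilinear {n} (ip : Vecℚ n → Vecℚ n → ℚ) : Set where
  field
    ip-cong : ∀ {u u′ v v′} → (∀ i → u i ≡ u′ i) → (∀ i → v i ≡ v′ i) → ip u v ≡ ip u′ v′
    ip-⊕ˡ : ∀ u u′ v → ip (u ⊕ u′) v ≡ ip u v ℚ.+ ip u′ v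
    ip-⊕ʳ : ∀ u v v′ → ip u (v ⊕ v′) ≡ ip u v ℚ.+ ip u v′
    ip-⊙ˡ : ∀ a u v → ip (a ⊙ u) v ≡ a ℚ.* ip u v
    ip-⊙ʳ : ∀ a u v → ip u (a ⊙ v) ≡ a ℚ.* ip u v

  combination : (a b c d : ℚ) (x y z w : Vecℚ n) → Vecℚ n
  combination a b c d x y z w = a ⊙ x ⊕ b ⊙ y ⊕ c ⊙ z ⊕ d ⊙ w

  ip-combinationˡ : ∀ a b c d x y z w v → ip (combination a b c d x y z w) v
    ≡ a ℚ.* ip x v ℚ.+ b ℚ.* ip y v ℚ.+ c ℚ.* ip z v ℚ.+ d ℚ.* ip w v
  ip-combinationˡ a b c d x y z w v = trans (ip-⊕ˡ (a ⊙ x ⊕ b ⊙ y ⊕ c ⊙ z) (d ⊙ w) v) (cong₂ ℚ._+_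
    (trans (ip-⊕ˡ (a ⊙ x ⊕ b ⊙ y) (c ⊙ z) v) (cong₂ ℚ._+_
      (trans (ip-⊕ˡ (a ⊙ x) (b ⊙ y) v) (cong₂ ℚ._+_ (ip-⊙ˡ a x v) (ip-⊙ˡ b y v)))
      (ip-⊙ˡ c z v))) (ip-⊙ˡ d w v))

  ip-combinationʳ : ∀ a b c d x y z w u → ip u (combination a b c d x y z w)
    ≡ a ℚ.* ip u x ℚ.+ b ℚ.* ip u y ℚ.+ c ℚ.* ip u z ℚ.+ d ℚ.* ip u w
  ip-combinationʳ a b c d x y z w u = trans (ip-⊕ʳ u (a ⊙ x ⊕ b ⊙ y ⊕ c ⊙ z) (d ⊙ w)) (cong₂ ℚ._+_
    (trans (ip-⊕ʳ u (a ⊙ x ⊕ b ⊙ y) (c ⊙ z)) (cong₂ ℚ._+_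
      (trans (ip-⊕ʳ u (a ⊙ x) (b ⊙ y)) (cong₂ ℚ._+_ (ip-⊙ʳ a u x) (ip-⊙ʳ b u y)))
      (ip-⊙ʳ c u z))) (ip-⊙ʳ d u w))

open Bilinear using (combination)

record QuaternionAction {n} (ip : Vecℚ n → Vecℚ n → ℚ) (t : ℚ) : Set where
  field
    I J : Mat n
    I² : ∀ x i → apply I (apply I x) i ≡ ℚ.- t ℚ.* apply I x i ℚ.+ ℚ.- 1ℚ ℚ.* x i
    J² : ∀ x i → apply J (apply J x) i ≡ ℚ.- 1ℚ ℚ.* x i
    IJ : ∀ x i → apply I (apply J x) i ≡ ℚ.- 1ℚ ℚ.* apply J (apply I x) i ℚ.+ ℚ.- t ℚ.* apply J x i
    I-skew : ∀ u v → ip (apply I u) v ≡ ℚ.- t ℚ.* ip u v ℚ.+ ℚ.- 1ℚ ℚ.* ip u (apply I v)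
    J-skew : ∀ u v → ip (apply J u) v ≡ ℚ.- 1ℚ ℚ.* ip u (apply J v)

module _ {n} {ip : Vecℚ n → Vecℚ n → ℚ} {t : ℚ} (bil : Bilinear ip) (act : QuaternionAction ip t) where
  open Bilinear bil hiding (combination)
  open QuaternionAction act
  open ≡-Reasoning
  open ℚ-Solver using (solve; con; _:+_; _:*_; _:=_; :-_; _:-_)

  norm-form : ℚ → ℚ → ℚ → ℚ → ℚ
  norm-form a b c d = (a ℚ.* a ℚ.- t ℚ.* a ℚ.* b ℚ.+ b ℚ.* b) ℚ.+ (c ℚ.* c ℚ.- t ℚ.* c ℚ.* d ℚ.+ d ℚ.* d)

  private
    i j ji : Vecℚ n → Vecℚ n
    i = apply I
    j = apply J
    ji x = j (i x)

    ip-neg : ∀ u v → ip u (ℚ.- 1ℚ ⊙ v) ≡ ℚ.- 1ℚ ℚ.* ip u v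
    ip-neg = ip-⊙ʳ (ℚ.- 1ℚ)

    ≗refl : ∀ {u : Vecℚ n} k → u k ≡ u k
    ≗refl _ = refl

    ⟨i,i⟩ : ∀ u v → ip (i u) (i v) ≡ ip u v
    ⟨i,i⟩ u v = begin
      ip (i u) (i v) ≡⟨ I-skew u (i v) ⟩
      ℚ.- t ℚ.* ip u (i v) ℚ.+ ℚ.- 1ℚ ℚ.* ip u (i (i v))
        ≡⟨ cong (λ z → ℚ.- t ℚ.* ip u (i v) ℚ.+ ℚ.- 1ℚ ℚ.* z) (begin
          ip u (i (i v)) ≡⟨ ip-cong ≗refl (I² v) ⟩
          ip u (ℚ.- t ⊙ i v ⊕ ℚ.- 1ℚ ⊙ v) ≡⟨ ip-⊕ʳ u (ℚ.- t ⊙ i v) (ℚ.- 1ℚ ⊙ v) ⟩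
          ip u (ℚ.- t ⊙ i v) ℚ.+ ip u (ℚ.- 1ℚ ⊙ v) ≡⟨ cong₂ ℚ._+_ (ip-⊙ʳ (ℚ.- t) u (i v)) (ip-neg u v) ⟩
          ℚ.- t ℚ.* ip u (i v) ℚ.+ ℚ.- 1ℚ ℚ.* ip u v ∎) ⟩
      ℚ.- t ℚ.* ip u (i v) ℚ.+ ℚ.- 1ℚ ℚ.* (ℚ.- t ℚ.* ip u (i v) ℚ.+ ℚ.- 1ℚ ℚ.* ip u v)
        ≡⟨ solve 3 (λ t q p → :- t :* q :+ con (ℚ.- 1ℚ) :* (:- t :* q :+ con (ℚ.- 1ℚ) :* p) := p) refl t (ip u (i v))
            (ip u v) ⟩
      ip u v ∎

    ⟨j,j⟩ : ∀ u v → ip (j u) (j v) ≡ ip u v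
    ⟨j,j⟩ u v = begin
      ip (j u) (j v) ≡⟨ J-skew u (j v) ⟩
      ℚ.- 1ℚ ℚ.* ip u (j (j v)) ≡⟨ cong (ℚ.- 1ℚ ℚ.*_) (trans (ip-cong ≗refl (J² v)) (ip-neg u v)) ⟩
      ℚ.- 1ℚ ℚ.* (ℚ.- 1ℚ ℚ.* ip u v) ≡⟨ solve 1 (λ p → con (ℚ.- 1ℚ) :* (con (ℚ.- 1ℚ) :* p) := p) refl (ip u v) ⟩
      ip u v ∎

    ⟨i,j⟩ : ∀ u v → ip (i u) (j v) ≡ ip u (ji v)
    ⟨i,j⟩ u v = begin
      ip (i u) (j v) ≡⟨ I-skew u (j v) ⟩
      ℚ.- t ℚ.* ip u (j v) ℚ.+ ℚ.- 1ℚ ℚ.* ip u (i (j v))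
        ≡⟨ cong (λ z → ℚ.- t ℚ.* ip u (j v) ℚ.+ ℚ.- 1ℚ ℚ.* z) (begin
          ip u (i (j v)) ≡⟨ ip-cong ≗refl (IJ v) ⟩
          ip u (ℚ.- 1ℚ ⊙ ji v ⊕ ℚ.- t ⊙ j v) ≡⟨ ip-⊕ʳ u (ℚ.- 1ℚ ⊙ ji v) (ℚ.- t ⊙ j v) ⟩
          ip u (ℚ.- 1ℚ ⊙ ji v) ℚ.+ ip u (ℚ.- t ⊙ j v) ≡⟨ cong₂ ℚ._+_ (ip-neg u (ji v)) (ip-⊙ʳ (ℚ.- t) u (j v)) ⟩
          ℚ.- 1ℚ ℚ.* ip u (ji v) ℚ.+ ℚ.- t ℚ.* ip u (j v) ∎) ⟩
      ℚ.- t ℚ.* ip u (j v) ℚ.+ ℚ.- 1ℚ ℚ.* (ℚ.- 1ℚ ℚ.* ip u (ji v) ℚ.+ ℚ.- t ℚ.* ip u (j v))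
        ≡⟨ solve 3 (λ t r s → :- t :* r :+ con (ℚ.- 1ℚ) :* (con (ℚ.- 1ℚ) :* s :+ :- t :* r) := s) refl t (ip u (j v))
            (ip u (ji v)) ⟩
      ip u (ji v) ∎

    ji-i : ∀ v k → ji (i v) k ≡ ℚ.- t ℚ.* ji v k ℚ.+ ℚ.- 1ℚ ℚ.* j v k
    ji-i v k = begin
      j (i (i v)) k ≡⟨ apply-cong J (I² v) k ⟩
      j (ℚ.- t ⊙ i v ⊕ ℚ.- 1ℚ ⊙ v) k ≡⟨ trans (∑ℚ.∑-cong (λ l → solve 5
          (λ a t x m y → a :* (t :* x :+ m :* y) := t :* (a :* x) :+ m :* (a :* y)) refl (J k l) (ℚ.- t) (i v l)
          (ℚ.- 1ℚ) (v l)))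
          (trans (∑ℚ.∑-+ (λ l → ℚ.- t ℚ.* (J k l ℚ.* i v l)) (λ l → ℚ.- 1ℚ ℚ.* (J k l ℚ.* v l)))
            (cong₂ ℚ._+_ (∑ℚ.∑-*ˡ (ℚ.- t) (λ l → J k l ℚ.* i v l)) (∑ℚ.∑-*ˡ (ℚ.- 1ℚ) (λ l → J k l ℚ.* v l)))) ⟩
      ℚ.- t ℚ.* ji v k ℚ.+ ℚ.- 1ℚ ℚ.* j v k ∎

    ⟨i,ji⟩ : ∀ u v → ip (i u) (ji v) ≡ ℚ.- t ℚ.* ip u (ji v) ℚ.+ ℚ.- 1ℚ ℚ.* ip u (j v)
    ⟨i,ji⟩ u v = begin
      ip (i u) (ji v) ≡⟨ ⟨i,j⟩ u (i v) ⟩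
      ip u (ji (i v)) ≡⟨ ip-cong ≗refl (ji-i v) ⟩
      ip u (ℚ.- t ⊙ ji v ⊕ ℚ.- 1ℚ ⊙ j v) ≡⟨ ip-⊕ʳ u (ℚ.- t ⊙ ji v) (ℚ.- 1ℚ ⊙ j v) ⟩
      ip u (ℚ.- t ⊙ ji v) ℚ.+ ip u (ℚ.- 1ℚ ⊙ j v) ≡⟨ cong₂ ℚ._+_ (ip-⊙ʳ (ℚ.- t) u (ji v)) (ip-neg u (j v)) ⟩
      ℚ.- t ℚ.* ip u (ji v) ℚ.+ ℚ.- 1ℚ ℚ.* ip u (j v) ∎

  quaternion : ℚ → ℚ → ℚ → ℚ → Mat n
  quaternion a b c d k l = a ℚ.* Identity k l ℚ.+ b ℚ.* I k l ℚ.+ c ℚ.* J k l ℚ.+ d ℚ.* (J ∙ I) k l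

  apply-quaternion : ∀ a b c d x k → apply (quaternion a b c d) x k ≡ combination bil a b c d x (i x) (j x) (ji x) k
  apply-quaternion a b c d x k = trans (apply-linear a b c d Identity I J (J ∙ I) x k)
    (cong₂ (λ y z → a ℚ.* y ℚ.+ b ℚ.* i x k ℚ.+ c ℚ.* j x k ℚ.+ d ℚ.* z) (apply-Identity x k) (apply-∙ J I x k))

  quaternion-similarity : ∀ a b c d → IsSimilarity ip (quaternion a b c d) (norm-form a b c d)
  quaternion-similarity a b c d u v = begin
    ip (apply (quaternion a b c d) u) (apply (quaternion a b c d) v)
      ≡⟨ ip-cong (apply-quaternion a b c d u) (apply-quaternion a b c d v) ⟩
    ip (combination bil a b c d u (i u) (j u) (ji u)) y
      ≡⟨ ip-combinationˡ a b c d u (i u) (j u) (ji u) y ⟩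
    a ℚ.* ip u y ℚ.+ b ℚ.* ip (i u) y ℚ.+ c ℚ.* ip (j u) y ℚ.+ d ℚ.* ip (ji u) y
      ≡⟨ cong₂ ℚ._+_ (cong₂ ℚ._+_ (cong₂ ℚ._+_
          (cong (a ℚ.*_) (expand u refl refl refl refl))
          (cong (b ℚ.*_) (expand (i u) (I-skew u v) (⟨i,i⟩ u v) (⟨i,j⟩ u v) (⟨i,ji⟩ u v))))
          (cong (c ℚ.*_) (expand (j u) (J-skew u v) (J-skew u (i v)) (⟨j,j⟩ u v) (⟨j,j⟩ u (i v)))))
          (cong (d ℚ.*_) (expand (ji u)
            (trans (J-skew (i u) v) (cong (ℚ.- 1ℚ ℚ.*_) (⟨i,j⟩ u v)))
            (trans (J-skew (i u) (i v)) (cong (ℚ.- 1ℚ ℚ.*_) (⟨i,ji⟩ u v)))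
            (trans (⟨j,j⟩ (i u) v) (I-skew u v))
            (trans (⟨j,j⟩ (i u) (i v)) (⟨i,i⟩ u v)))) ⟩
    _ ≡⟨ solve 9 (λ t a b c d P Q R S → let m = con (ℚ.- 1ℚ) in
           a :* (a :* P :+ b :* Q :+ c :* R :+ d :* S)
           :+ b :* (a :* (:- t :* P :+ m :* Q) :+ b :* P :+ c :* S :+ d :* (:- t :* S :+ m :* R))
           :+ c :* (a :* (m :* R) :+ b :* (m :* S) :+ c :* P :+ d :* Q)
           :+ d :* (a :* (m :* S) :+ b :* (m :* (:- t :* S :+ m :* R)) :+ c :* (:- t :* P :+ m :* Q) :+ d :* P)
           := ((a :* a :- t :* a :* b :+ b :* b) :+ (c :* c :- t :* c :* d :+ d :* d)) :* P)
           refl t a b c d (ip u v) (ip u (i v)) (ip u (j v)) (ip u (ji v)) ⟩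
    norm-form a b c d ℚ.* ip u v ∎
    where
    y : Vecℚ n
    y = combination bil a b c d v (i v) (j v) (ji v)
    expand : ∀ w {p q r s} → ip w v ≡ p → ip w (i v) ≡ q → ip w (j v) ≡ r → ip w (ji v) ≡ s →
      ip w y ≡ a ℚ.* p ℚ.+ b ℚ.* q ℚ.+ c ℚ.* r ℚ.+ d ℚ.* s
    expand w refl refl refl refl = ip-combinationʳ a b c d v (i v) (j v) (ji v) w

record IsSubgroup {n} (Λ : Lattice n) : Set where
  field
    respects : ∀ {x y} → (∀ i → x i ≡ y i) → Λ x → Λ y
    ⊕-closed : ∀ {x y} → Λ x → Λ y → Λ (x ⊕ y)
    neg-closed : ∀ {x} → Λ x → Λ (λ i → ℚ.- x i)

  ι⁺-closed : ∀ n {x} → Λ x → Λ (ι (+ n) ⊙ x)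
  ι⁺-closed zero {x} x∈ = respects (λ i → trans (ℚₚ.+-inverseʳ (x i)) (sym (ℚₚ.*-zeroˡ (x i))))
      (⊕-closed x∈ (neg-closed x∈))
  ι⁺-closed (suc n) {x} x∈ = respects (λ i → trans (cong (ℚ._+ ι (+ n) ℚ.* x i) (sym (ℚₚ.*-identityˡ (x i))))
    (trans (sym (ℚₚ.*-distribʳ-+ (x i) 1ℚ (ι (+ n)))) (cong (ℚ._* x i) (sym (ι-+ (+ 1) (+ n))))))
    (⊕-closed x∈ (ι⁺-closed n x∈))

  ι-closed : ∀ z {x} → Λ x → Λ (ι z ⊙ x)
  ι-closed (+ n) = ι⁺-closed n
  ι-closed -[1+ n ] {x} x∈ = respects (λ i → trans (ℚₚ.neg-distribˡ-* (ι +[1+ n ]) (x i))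
      (cong (ℚ._* x i) (sym (ι-neg +[1+ n ]))))
    (neg-closed (ι⁺-closed (suc n) x∈))

Preserves : ∀ {n} → Lattice n → Mat n → Set
Preserves Λ A = ∀ x → Λ x → Λ (apply A x)

module _ {n} {ip : Vecℚ n → Vecℚ n → ℚ} {t e} (wt : Weight t e) (bil : Bilinear ip)
         (act : QuaternionAction ip (ι t)) {Λ : Lattice n} (sub : IsSubgroup Λ) where
  open QuaternionAction act
  open IsSubgroup sub

  norm-form-ι : ∀ x → let open Quat in
    norm-form bil act (ι (c₀ x)) (ι (c₁ x)) (ι (c₂ x)) (ι (c₃ x)) ≡ ι (N t x)
  norm-form-ι (quat a b c d) = sym (trans (ι-+ (norm² t a b) (norm² t c d)) (cong₂ ℚ._+_ (half a b) (half c d)))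
    where
    half : ∀ a b → ι (norm² t a b) ≡ ι a ℚ.* ι a ℚ.- ι t ℚ.* ι a ℚ.* ι b ℚ.+ ι b ℚ.* ι b
    half a b = trans (ι-+ (a ℤ.* a ℤ.- t ℤ.* a ℤ.* b) (b ℤ.* b)) (cong₂ ℚ._+_
      (trans (ι-- (a ℤ.* a) (t ℤ.* a ℤ.* b)) (cong₂ ℚ._-_ (ι-* a a)
          (trans (ι-* (t ℤ.* a) b) (cong (ℚ._* ι b) (ι-* t a)))))
      (ι-* b b))

  hasMultiplier : Preserves Λ I → Preserves Λ J → ∀ c → 1 ℕ.≤ c → HasMultiplier ip Λ (ι (+ c))
  hasMultiplier I-pres J-pres c 1≤c with universal wt c 1≤c
  ... | q@(quat z₀ z₁ z₂ z₃) , Nq≡c = quaternion bil act (ι z₀) (ι z₁) (ι z₂) (ι z₃)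
    , subst (IsSimilarity ip (quaternion bil act (ι z₀) (ι z₁) (ι z₂) (ι z₃))) (trans (norm-form-ι q) (cong ι Nq≡c))
        (quaternion-similarity bil act (ι z₀) (ι z₁) (ι z₂) (ι z₃))
    , λ x x∈ → respects (λ i → sym (apply-quaternion bil act (ι z₀) (ι z₁) (ι z₂) (ι z₃) x i))
        (⊕-closed (⊕-closed (⊕-closed (ι-closed z₀ x∈) (ι-closed z₁ (I-pres x x∈))) (ι-closed z₂ (J-pres x x∈)))
          (ι-closed z₃ (J-pres _ (I-pres x x∈))))

dot-bilinear : ∀ {n} → Bilinear (dot {n})
dot-bilinear = record
  { ip-cong = λ u≗ v≗ → ∑ℚ.∑-cong (λ i → cong₂ ℚ._*_ (u≗ i) (v≗ i))
  ; ip-⊕ˡ = λ u u′ v → trans (∑ℚ.∑-cong (λ i → ℚₚ.*-distribʳ-+ (v i) (u i) (u′ i)))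
      (∑ℚ.∑-+ (λ i → u i ℚ.* v i) (λ i → u′ i ℚ.* v i))
  ; ip-⊕ʳ = λ u v v′ → trans (∑ℚ.∑-cong (λ i → ℚₚ.*-distribˡ-+ (u i) (v i) (v′ i)))
      (∑ℚ.∑-+ (λ i → u i ℚ.* v i) (λ i → u i ℚ.* v′ i))
  ; ip-⊙ˡ = λ a u v → trans (∑ℚ.∑-cong (λ i → ℚₚ.*-assoc a (u i) (v i))) (∑ℚ.∑-*ˡ a (λ i → u i ℚ.* v i))
  ; ip-⊙ʳ = λ a u v → trans (∑ℚ.∑-cong (λ i → rotate a (u i) (v i))) (∑ℚ.∑-*ˡ a (λ i → u i ℚ.* v i))
  }
  where
  open ℚ-Solver
  rotate : ∀ a u v → u ℚ.* (a ℚ.* v) ≡ a ℚ.* (u ℚ.* v)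
  rotate = solve 3 (λ a u v → u :* (a :* v) := a :* (u :* v)) refl

apply-⊕ : ∀ {n} (A : Mat n) x y i → apply A (x ⊕ y) i ≡ (apply A x ⊕ apply A y) i
apply-⊕ A x y i = Bilinear.ip-⊕ʳ dot-bilinear (A i) x y

apply-⊙ : ∀ {n} (A : Mat n) a x i → apply A (a ⊙ x) i ≡ (a ⊙ apply A x) i
apply-⊙ A a x i = Bilinear.ip-⊙ʳ dot-bilinear a (A i) x

inner-dot : ∀ {n} (G : Form n) u v → inner G u v ≡ dot u (apply G v)
inner-dot G u v = ∑ℚ.∑-cong (λ i → ∑ℚ.∑-*ˡ (u i) (λ j → G i j ℚ.* v j))

inner-bilinear : ∀ {n} (G : Form n) → Bilinear (inner G)
inner-bilinear G = record
  { ip-cong = λ {u} {u′} {v} {v′} u≗ v≗ → via {u} {u′} {v} {v′}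
      (ip-cong {u} {u′} {apply G v} {apply G v′} u≗ (apply-cong G v≗))
  ; ip-⊕ˡ = λ u u′ v → trans (inner-dot G (u ⊕ u′) v) (trans (ip-⊕ˡ u u′ (apply G v))
      (sym (cong₂ ℚ._+_ (inner-dot G u v) (inner-dot G u′ v))))
  ; ip-⊕ʳ = λ u v v′ → trans (inner-dot G u (v ⊕ v′)) (trans (ip-cong {u} (λ _ → refl) (apply-⊕ G v v′))
      (trans (ip-⊕ʳ u (apply G v) (apply G v′)) (sym (cong₂ ℚ._+_ (inner-dot G u v) (inner-dot G u v′)))))
  ; ip-⊙ˡ = λ a u v → trans (inner-dot G (a ⊙ u) v) (trans (ip-⊙ˡ a u (apply G v))
      (cong (a ℚ.*_) (sym (inner-dot G u v))))
  ; ip-⊙ʳ = λ a u v → trans (inner-dot G u (a ⊙ v)) (trans (ip-cong {u} (λ _ → refl) (apply-⊙ G a v))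
      (trans (ip-⊙ʳ a u (apply G v)) (cong (a ℚ.*_) (sym (inner-dot G u v)))))
  }
  where
  open Bilinear dot-bilinear
  via : ∀ {u u′ v v′} → dot u (apply G v) ≡ dot u′ (apply G v′) → inner G u v ≡ inner G u′ v′
  via {u} {u′} {v} {v′} eq = trans (inner-dot G u v) (trans eq (sym (inner-dot G u′ v′)))

-- Signed permutations

χ : Bool → ℤ
χ true = + 1
χ false = + 0

sign : Bool → ℤ
sign b = + 1 ℤ.- + 2 ℤ.* χ b

sign² : ∀ b → ι (sign b) ℚ.* ι (sign b) ≡ 1ℚ
sign² true = refl
sign² false = refl

sign-not : ∀ b → ι (sign (not b)) ≡ ℚ.- 1ℚ ℚ.* ι (sign b)
sign-not true = refl
sign-not false = refl

sign-xor : ∀ b c → ι (sign b) ℚ.* ι (sign c) ≡ ι (sign (b xor c))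
sign-xor true true = refl
sign-xor true false = refl
sign-xor false true = refl
sign-xor false false = refl

-- The signed permutation matrix x ↦ (± x (π i))ᵢ with square -1; `minus` marks the minus signs.
record SignedPerm (n : ℕ) : Set where
  field
    π : Fin n → Fin n
    minus : Fin n → Bool
    π-involutive : ∀ i → π (π i) ≡ i
    minus-π : ∀ i → minus (π i) ≡ not (minus i)

  matrix : Mat n
  matrix i j = if does (j ≟ π i) then ι (sign (minus i)) else 0ℚ

  apply-matrix : ∀ x i → apply matrix x i ≡ ι (sign (minus i)) ℚ.* x (π i)
  apply-matrix = apply-monomial π (λ i → ι (sign (minus i)))

  matrix² : ∀ x i → apply matrix (apply matrix x) i ≡ ℚ.- 1ℚ ℚ.* x i
  matrix² x i = begin
    apply matrix (apply matrix x) i ≡⟨ apply-matrix (apply matrix x) i ⟩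
    ι (sign (minus i)) ℚ.* apply matrix x (π i) ≡⟨ cong (ι (sign (minus i)) ℚ.*_) (apply-matrix x (π i)) ⟩
    ι (sign (minus i)) ℚ.* (ι (sign (minus (π i))) ℚ.* x (π (π i)))
      ≡⟨ cong₂ (λ b j → ι (sign (minus i)) ℚ.* (ι (sign b) ℚ.* x j)) (minus-π i) (π-involutive i) ⟩
    ι (sign (minus i)) ℚ.* (ι (sign (not (minus i))) ℚ.* x i)
      ≡⟨ cong (λ s → ι (sign (minus i)) ℚ.* (s ℚ.* x i)) (sign-not (minus i)) ⟩
    s ℚ.* ((ℚ.- 1ℚ ℚ.* s) ℚ.* x i) ≡⟨ solve 2 (λ s x → s :* ((con (ℚ.- 1ℚ) :* s) :* x) := con (ℚ.- 1ℚ) :* (s :* s) :*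
        x) refl s (x i) ⟩
    ℚ.- 1ℚ ℚ.* (s ℚ.* s) ℚ.* x i ≡⟨ cong (λ z → ℚ.- 1ℚ ℚ.* z ℚ.* x i) (sign² (minus i)) ⟩
    ℚ.- 1ℚ ℚ.* x i ∎
    where
    open ≡-Reasoning
    open ℚ-Solver
    s : ℚ
    s = ι (sign (minus i))

  matrix-skew : ∀ u v → dot (apply matrix u) v ≡ ℚ.- 1ℚ ℚ.* dot u (apply matrix v)
  matrix-skew u v = begin
    ∑ℚ (λ i → apply matrix u i ℚ.* v i) ≡⟨ ∑ℚ.∑-cong (λ i → cong (ℚ._* v i) (apply-matrix u i)) ⟩
    ∑ℚ f ≡⟨ ∑ℚ.∑-involution π π-involutive f ⟩
    ∑ℚ (λ i → f (π i)) ≡⟨ ∑ℚ.∑-cong (λ i → begin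
      ι (sign (minus (π i))) ℚ.* u (π (π i)) ℚ.* v (π i)
        ≡⟨ cong₂ (λ b j → ι (sign b) ℚ.* u j ℚ.* v (π i)) (minus-π i) (π-involutive i) ⟩
      ι (sign (not (minus i))) ℚ.* u i ℚ.* v (π i)
        ≡⟨ cong (λ z → z ℚ.* u i ℚ.* v (π i)) (sign-not (minus i)) ⟩
      ℚ.- 1ℚ ℚ.* ι (sign (minus i)) ℚ.* u i ℚ.* v (π i)
        ≡⟨ solve 4 (λ m s u v → m :* s :* u :* v := m :* (u :* (s :* v))) refl (ℚ.- 1ℚ) (ι (sign (minus i))) (u i)
            (v (π i)) ⟩
      ℚ.- 1ℚ ℚ.* (u i ℚ.* (ι (sign (minus i)) ℚ.* v (π i)))
        ≡⟨ cong (λ z → ℚ.- 1ℚ ℚ.* (u i ℚ.* z)) (apply-matrix v i) ⟨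
      ℚ.- 1ℚ ℚ.* (u i ℚ.* apply matrix v i) ∎) ⟩
    ∑ℚ (λ i → ℚ.- 1ℚ ℚ.* (u i ℚ.* apply matrix v i)) ≡⟨ ∑ℚ.∑-*ˡ (ℚ.- 1ℚ) (λ i → u i ℚ.* apply matrix v i) ⟩
    ℚ.- 1ℚ ℚ.* dot u (apply matrix v) ∎
    where
    open ≡-Reasoning
    open ℚ-Solver
    f : Fin n → ℚ
    f i = ι (sign (minus i)) ℚ.* u (π i) ℚ.* v i

  signed-sum : ∀ y → ∑ℤ (λ i → sign (minus i) ℤ.* y (π i)) ≡ ∑ℤ y ℤ.- + 2 ℤ.* ∑ℤ (λ i → χ (minus i) ℤ.* y (π i))
  signed-sum y = begin
    ∑ℤ (λ i → sign (minus i) ℤ.* y (π i))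
      ≡⟨ ∑ℤ.∑-cong (λ i → solve 2 (λ b y → (con (+ 1) :- con (+ 2) :* b) :* y := y :+ con (ℤ.- + 2) :* (b :* y)) refl
          (χ (minus i)) (y (π i))) ⟩
    ∑ℤ (λ i → y (π i) ℤ.+ ℤ.- + 2 ℤ.* (χ (minus i) ℤ.* y (π i)))
      ≡⟨ ∑ℤ.∑-+ (y ∘ π) (λ i → ℤ.- + 2 ℤ.* (χ (minus i) ℤ.* y (π i))) ⟩
    ∑ℤ (y ∘ π) ℤ.+ ∑ℤ (λ i → ℤ.- + 2 ℤ.* (χ (minus i) ℤ.* y (π i)))
      ≡⟨ cong₂ ℤ._+_ (sym (∑ℤ.∑-involution π π-involutive y)) (∑ℤ.∑-*ˡ (ℤ.- + 2) (λ i → χ (minus i) ℤ.* y (π i))) ⟩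
    ∑ℤ y ℤ.+ ℤ.- + 2 ℤ.* B ≡⟨ solve 2 (λ s b → s :+ con (ℤ.- + 2) :* b := s :- con (+ 2) :* b) refl (∑ℤ y) B ⟩
    ∑ℤ y ℤ.- + 2 ℤ.* B ∎
    where
    open ≡-Reasoning
    open ℤ-Solver
    B : ℤ
    B = ∑ℤ (λ i → χ (minus i) ℤ.* y (π i))

  twice-minus-count : + 2 ℤ.* ∑ℤ (λ i → χ (minus i)) ≡ ∑ℤ {n} (λ _ → + 1)
  twice-minus-count = begin
    + 2 ℤ.* B ≡⟨ solve 1 (λ b → con (+ 2) :* b := b :+ b) refl B ⟩
    B ℤ.+ B ≡⟨ cong (λ z → B ℤ.+ z) (∑ℤ.∑-involution π π-involutive (χ ∘ minus)) ⟩
    B ℤ.+ ∑ℤ (λ i → χ (minus (π i))) ≡⟨ ∑ℤ.∑-+ (χ ∘ minus) (χ ∘ minus ∘ π) ⟨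
    ∑ℤ (λ i → χ (minus i) ℤ.+ χ (minus (π i))) ≡⟨ ∑ℤ.∑-cong (λ i → trans (cong (λ b → χ (minus i) ℤ.+ χ b) (minus-π i))
        (one (minus i))) ⟩
    ∑ℤ {n} (λ _ → + 1) ∎
    where
    open ≡-Reasoning
    open ℤ-Solver
    B : ℤ
    B = ∑ℤ (χ ∘ minus)
    one : ∀ b → χ b ℤ.+ χ (not b) ≡ + 1
    one true = refl
    one false = refl

open SignedPerm

record Anticommute {n} (p q : SignedPerm n) : Set where
  field
    π-comm : ∀ i → π q (π p i) ≡ π p (π q i)
    minus-anti : ∀ i → minus p i xor minus q (π p i) ≡ not (minus q i xor minus p (π q i))

signed-action : ∀ {n} {p q : SignedPerm n} → Anticommute p q → QuaternionAction dot (ι (+ 0))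
signed-action {n} {p} {q} anti = record
  { I = matrix p
  ; J = matrix q
  ; I² = λ x i → trans (matrix² p x i) (pad (apply (matrix p) x i) (ℚ.- 1ℚ ℚ.* x i))
  ; J² = matrix² q
  ; IJ = λ x i → trans (commute x i) (trans (pad (apply (matrix q) x i)
      (ℚ.- 1ℚ ℚ.* apply (matrix q) (apply (matrix p) x) i))
      (ℚₚ.+-comm (ℚ.- 0ℚ ℚ.* apply (matrix q) x i) _))
  ; I-skew = λ u v → trans (matrix-skew p u v) (pad (dot u v) (ℚ.- 1ℚ ℚ.* dot u (apply (matrix p) v)))
  ; J-skew = matrix-skew q
  }
  where
  open Anticommute anti
  pad : ∀ z w → w ≡ ℚ.- 0ℚ ℚ.* z ℚ.+ w
  pad z w = sym (trans (cong (ℚ._+ w) (ℚₚ.*-zeroˡ z)) (ℚₚ.+-identityˡ w))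
  composite : ∀ (p q : SignedPerm n) x i → apply (matrix p) (apply (matrix q) x) i ≡ ι
      (sign (minus p i xor minus q (π p i))) ℚ.* x (π q (π p i))
  composite p q x i = trans (apply-matrix p _ i) (trans (cong (ι (sign (minus p i)) ℚ.*_) (apply-matrix q x (π p i)))
    (trans (sym (ℚₚ.*-assoc (ι (sign (minus p i))) _ _)) (cong (ℚ._* x (π q (π p i)))
        (sign-xor (minus p i) (minus q (π p i))))))
  commute : ∀ x i → apply (matrix p) (apply (matrix q) x) i ≡ ℚ.- 1ℚ ℚ.* apply (matrix q) (apply (matrix p) x) i
  commute x i = trans (composite p q x i) (trans (cong₂ (λ b j → ι (sign b) ℚ.* x j) (minus-anti i) (π-comm i))
    (trans (cong (ℚ._* x (π p (π q i))) (sign-not (minus q i xor minus p (π q i))))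
        (trans (ℚₚ.*-assoc (ℚ.- 1ℚ) (ι (sign (minus q i xor minus p (π q i)))) (x (π p (π q i))))
      (cong (ℚ.- 1ℚ ℚ.*_) (sym (composite q p x i))))))

open Signed using (divides; ∣ᵤ⇒∣; ∣⇒∣ᵤ)

∑ℤ-neg : ∀ {n} (y : Vecℤ n) → ∑ℤ (λ i → ℤ.- y i) ≡ ℤ.- ∑ℤ y
∑ℤ-neg y = trans (∑ℤ.∑-cong (λ i → sym (ℤₚ.-1*i≡-i (y i)))) (trans (∑ℤ.∑-*ˡ (ℤ.- + 1) y) (ℤₚ.-1*i≡-i (∑ℤ y)))

∑ℤ-ones : ∀ n → ∑ℤ {n} (λ _ → + 1) ≡ + n
∑ℤ-ones zero = refl
∑ℤ-ones (suc n) = cong (λ z → + 1 ℤ.+ z) (∑ℤ-ones n)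

signed : ∀ {n} → SignedPerm n → Vecℤ n → Vecℤ n
signed p y i = sign (minus p i) ℤ.* y (π p i)

module _ {n} {P : Vecℤ n → Set} where

  IntVecWith-subgroup : (∀ {y z} → P y → P z → P (λ i → y i ℤ.+ z i)) → (∀ {y} → P y → P (λ i → ℤ.- y i)) →
    IsSubgroup (IntVecWith P)
  IntVecWith-subgroup +-closed neg-closed = record
    { respects = λ { x≗ (y , x≡ , Py) → y , (λ i → trans (sym (x≗ i)) (x≡ i)) , Py }
    ; ⊕-closed = λ { (y , x≡ , Py) (y′ , x′≡ , Py′) → (λ i → y i ℤ.+ y′ i)
        , (λ i → trans (cong₂ ℚ._+_ (x≡ i) (x′≡ i)) (sym (ι-+ (y i) (y′ i)))) , +-closed Py Py′ }
    ; neg-closed = λ { (y , x≡ , Py) → (λ i → ℤ.- y i) , (λ i → trans (cong ℚ.-_ (x≡ i)) (sym (ι-neg (y i)))) ,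
        neg-closed Py }
    }

  IntVecWith-signed : ∀ p → (∀ {y} → P y → P (signed p y)) → Preserves (IntVecWith P) (matrix p)
  IntVecWith-signed p closed x (y , x≡ , Py) = signed p y
    , (λ i → trans (apply-matrix p x i) (trans (cong (ι (sign (minus p i)) ℚ.*_) (x≡ (π p i)))
        (sym (ι-* (sign (minus p i)) (y (π p i))))))
    , closed Py

Zlat-subgroup : ∀ n → IsSubgroup (Zlat n)
Zlat-subgroup n = IntVecWith-subgroup (λ _ _ → tt) (λ _ → tt)

Zlat-signed : ∀ {n} (p : SignedPerm n) → Preserves (Zlat n) (matrix p)
Zlat-signed p = IntVecWith-signed p (λ _ → tt)

∣-+ : ∀ k x y → k ∣ x → k ∣ y → k ∣ x ℤ.+ y
∣-+ k x y k∣x k∣y = ∣⇒∣ᵤ (Signed.∣m∣n⇒∣m+n (∣ᵤ⇒∣ {k} {x} k∣x) (∣ᵤ⇒∣ {k} {y} k∣y))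

∣-neg : ∀ k x → k ∣ x → k ∣ ℤ.- x
∣-neg k x k∣x = ∣⇒∣ᵤ (Signed.∣m⇒∣-m (∣ᵤ⇒∣ {k} {x} k∣x))

∣-multiple : ∀ k q {x} → x ≡ q ℤ.* k → k ∣ x
∣-multiple k q x≡ = ∣⇒∣ᵤ (divides q x≡)

∣-∑-+ : ∀ {n} k (y z : Vecℤ n) → k ∣ ∑ℤ y → k ∣ ∑ℤ z → k ∣ ∑ℤ (λ i → y i ℤ.+ z i)
∣-∑-+ k y z k∣y k∣z = subst (k ∣_) (sym (∑ℤ.∑-+ y z)) (∣-+ k (∑ℤ y) (∑ℤ z) k∣y k∣z)

∣-∑-neg : ∀ {n} k (y : Vecℤ n) → k ∣ ∑ℤ y → k ∣ ∑ℤ (λ i → ℤ.- y i)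
∣-∑-neg k y k∣y = subst (k ∣_) (sym (∑ℤ-neg y)) (∣-neg k (∑ℤ y) k∣y)

Dlat-subgroup : ∀ n → IsSubgroup (Dlat n)
Dlat-subgroup n = IntVecWith-subgroup (λ {y} {z} → ∣-∑-+ (+ 2) y z) (λ {y} → ∣-∑-neg (+ 2) y)

signed-sum-even : ∀ {n} (p : SignedPerm n) y → + 2 ∣ ∑ℤ y → + 2 ∣ ∑ℤ (signed p y)
signed-sum-even p y 2∣y = subst (+ 2 ∣_) (sym (signed-sum p y))
  (∣-+ (+ 2) (∑ℤ y) (ℤ.- (+ 2 ℤ.* B)) 2∣y (∣-neg (+ 2) (+ 2 ℤ.* B) (∣-multiple (+ 2) B (ℤₚ.*-comm (+ 2) B))))
  where
  B : ℤ
  B = ∑ℤ (λ i → χ (minus p i) ℤ.* y (π p i))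

Dlat-signed : ∀ {n} (p : SignedPerm n) → Preserves (Dlat n) (matrix p)
Dlat-signed p = IntVecWith-signed p (λ {y} → signed-sum-even p y)

module _ {n : ℕ} (2∣n : + 2 ∣ ∑ℤ {n} (λ _ → + 1)) where
  private module D = IsSubgroup (Dlat-subgroup n)

  ones : Dlat n (λ _ → 1ℚ)
  ones = (λ _ → + 1) , (λ _ → refl) , 2∣n

  Dplus-subgroup : IsSubgroup (Dplus n)
  Dplus-subgroup = record { respects = resp ; ⊕-closed = add ; neg-closed = neg }
    where
    open ℚ-Solver
    resp : ∀ {x y} → (∀ i → x i ≡ y i) → Dplus n x → Dplus n y
    resp x≗ (inj₁ d) = inj₁ (D.respects x≗ d)
    resp x≗ (inj₂ d) = inj₂ (D.respects (λ i → cong (ℚ._- ½) (x≗ i)) d)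
    add : ∀ {x y} → Dplus n x → Dplus n y → Dplus n (x ⊕ y)
    add (inj₁ d) (inj₁ e) = inj₁ (D.⊕-closed d e)
    add {x} {y} (inj₁ d) (inj₂ e) = inj₂ (D.respects (λ i → solve 3 (λ x y h → x :+ (y :- h) := x :+ y :- h) refl (x i)
        (y i) ½) (D.⊕-closed d e))
    add {x} {y} (inj₂ d) (inj₁ e) = inj₂ (D.respects (λ i → solve 3 (λ x y h → (x :- h) :+ y := x :+ y :- h) refl (x i)
        (y i) ½) (D.⊕-closed d e))
    add {x} {y} (inj₂ d) (inj₂ e) = inj₁ (D.respects (λ i → solve 2
        (λ x y → (x :- con ½) :+ (y :- con ½) :+ con 1ℚ := x :+ y) refl (x i) (y i))
      (D.⊕-closed (D.⊕-closed d e) ones))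
    neg : ∀ {x} → Dplus n x → Dplus n (λ i → ℚ.- x i)
    neg (inj₁ d) = inj₁ (D.neg-closed d)
    neg {x} (inj₂ d) = inj₂ (D.respects (λ i → solve 1 (λ x → :- ((x :- con ½) :+ con 1ℚ) := :- x :- con ½) refl (x i))
        (D.neg-closed (D.⊕-closed d ones)))

Dplus-signed : ∀ {n} (p : SignedPerm n) → + 2 ∣ ∑ℤ (λ i → χ (minus p i)) → Preserves (Dplus n) (matrix p)
Dplus-signed p _ x (inj₁ d) = inj₁ (Dlat-signed p x d)
Dplus-signed p even x (inj₂ (y , x≡ , 2∣y)) = inj₂ ((λ i → signed p y i ℤ.- χ (minus p i)) , shifted
  , ∣-∑-+ (+ 2) (signed p y) (λ i → ℤ.- χ (minus p i)) (signed-sum-even p y 2∣y) (∣-∑-neg (+ 2) (χ ∘ minus p) even))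
  where
  half : ∀ b → ι (sign b) ℚ.* ½ ℚ.- ½ ≡ ℚ.- ι (χ b)
  half true = refl
  half false = refl
  open ≡-Reasoning
  open ℚ-Solver
  shifted : ∀ i → apply (matrix p) x i ℚ.- ½ ≡ ι (signed p y i ℤ.- χ (minus p i))
  shifted i = begin
    apply (matrix p) x i ℚ.- ½ ≡⟨ cong (ℚ._- ½) (apply-matrix p x i) ⟩
    s ℚ.* x (π p i) ℚ.- ½ ≡⟨ solve 3 (λ s x h → s :* x :- h := s :* (x :- h) :+ (s :* h :- h)) refl s (x (π p i)) ½ ⟩
    s ℚ.* (x (π p i) ℚ.- ½) ℚ.+ (s ℚ.* ½ ℚ.- ½) ≡⟨ cong₂ ℚ._+_ (cong (s ℚ.*_) (x≡ (π p i))) (half (minus p i)) ⟩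
    s ℚ.* ι (y (π p i)) ℚ.- ι (χ (minus p i)) ≡⟨ cong (ℚ._- ι (χ (minus p i))) (ι-* (sign (minus p i)) (y (π p i))) ⟨
    ι (signed p y i) ℚ.- ι (χ (minus p i)) ≡⟨ ι-- (signed p y i) (χ (minus p i)) ⟨
    ι (signed p y i ℤ.- χ (minus p i)) ∎
    where
    s : ℚ
    s = ι (sign (minus p i))

-- The lattices ℤ⁴ᵐ, D₄ₘ and D₄ₘ⁺

decide-Fin : ∀ {n k} {f g : Fin n → Fin k} → {p : True (Finₚ.all? (λ i → f i ≟ g i))} → ∀ i → f i ≡ g i
decide-Fin {p = p} = toWitness p

decide-Bool : ∀ {n} {f g : Fin n → Bool} → {p : True (Finₚ.all? (λ i → f i ≟ᵇ g i))} → ∀ i → f i ≡ g i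
decide-Bool {p = p} = toWitness p

fromTables : ∀ {n} (πs : Vec (Fin n) n) (ms : Vec Bool n) →
  (∀ i → lookup πs (lookup πs i) ≡ i) → (∀ i → lookup ms (lookup πs i) ≡ not (lookup ms i)) → SignedPerm n
fromTables πs ms inv anti = record { π = lookup πs ; minus = lookup ms ; π-involutive = inv ; minus-π = anti }

hamilton-I hamilton-J : SignedPerm 4
hamilton-I = fromTables (1F ∷ 0F ∷ 3F ∷ 2F ∷ []) (true ∷ false ∷ true ∷ false ∷ [])
  decide-Fin decide-Bool
hamilton-J = fromTables (2F ∷ 3F ∷ 0F ∷ 1F ∷ []) (true ∷ false ∷ false ∷ true ∷ [])
  decide-Fin decide-Bool

hamilton-anticommute : Anticommute hamilton-I hamilton-J
hamilton-anticommute = record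
  { π-comm = decide-Fin ; minus-anti = decide-Bool }

module _ {k : ℕ} (m : ℕ) where

  inflate : SignedPerm k → SignedPerm (k ℕ.* m)
  inflate p = record
    { π = λ i → combine (π p (proj₁ (remQuot {k} m i))) (proj₂ (remQuot {k} m i))
    ; minus = λ i → minus p (proj₁ (remQuot {k} m i))
    ; π-involutive = λ i → trans (cong (λ kj → combine (π p (proj₁ kj)) (proj₂ kj))
        (Finₚ.remQuot-combine (π p (proj₁ (remQuot {k} m i))) (proj₂ (remQuot {k} m i))))
        (trans (cong (λ l → combine l (proj₂ (remQuot {k} m i))) (π-involutive p (proj₁ (remQuot {k} m i))))
            (Finₚ.combine-remQuot {k} m i))
    ; minus-π = λ i → trans (cong (minus p ∘ proj₁) (Finₚ.remQuot-combine (π p (proj₁ (remQuot {k} m i)))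
        (proj₂ (remQuot {k} m i)))) (minus-π p (proj₁ (remQuot {k} m i)))
    }

  inflate-anticommute : ∀ {p q} → Anticommute p q → Anticommute (inflate p) (inflate q)
  inflate-anticommute {p} {q} anti = record
    { π-comm = λ i → trans (cong (λ kj → combine (π q (proj₁ kj)) (proj₂ kj))
        (Finₚ.remQuot-combine (π p (proj₁ (remQuot {k} m i))) (proj₂ (remQuot {k} m i))))
        (trans (cong (λ l → combine l (proj₂ (remQuot {k} m i))) (Anticommute.π-comm anti (proj₁ (remQuot {k} m i))))
        (sym (cong (λ kj → combine (π p (proj₁ kj)) (proj₂ kj))
            (Finₚ.remQuot-combine (π q (proj₁ (remQuot {k} m i))) (proj₂ (remQuot {k} m i))))))
    ; minus-anti = λ i → trans (cong (λ kj → minus p (proj₁ (remQuot {k} m i)) xor minus q (proj₁ kj))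
        (Finₚ.remQuot-combine (π p (proj₁ (remQuot {k} m i))) (proj₂ (remQuot {k} m i))))
        (trans (Anticommute.minus-anti anti (proj₁ (remQuot {k} m i)))
        (sym (cong (λ kj → not (minus q (proj₁ (remQuot {k} m i)) xor minus p (proj₁ kj)))
            (Finₚ.remQuot-combine (π q (proj₁ (remQuot {k} m i))) (proj₂ (remQuot {k} m i))))))
    }

minus-count : ∀ m (p : SignedPerm (4 ℕ.* m)) → ∑ℤ (λ i → χ (minus p i)) ≡ + (2 ℕ.* m)
minus-count m p = ℤₚ.*-cancelˡ-≡ (+ 2) _ _ (trans (twice-minus-count p) (trans (∑ℤ-ones (4 ℕ.* m))
  (trans (cong +_ (ℕₚ.*-assoc 2 2 m)) (ℤₚ.pos-* 2 (2 ℕ.* m)))))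

module _ (m : ℕ) where
  I₄ₘ J₄ₘ : SignedPerm (4 ℕ.* m)
  I₄ₘ = inflate m hamilton-I
  J₄ₘ = inflate m hamilton-J

  quaternion-action : QuaternionAction dot (ι (+ 0))
  quaternion-action = signed-action (inflate-anticommute m hamilton-anticommute)

  minus-count-even : ∀ (p : SignedPerm (4 ℕ.* m)) → + 2 ∣ ∑ℤ (λ i → χ (minus p i))
  minus-count-even p = subst (+ 2 ∣_) (sym (minus-count m p))
      (∣-multiple (+ 2) (+ m) (trans (ℤₚ.pos-* 2 m) (ℤₚ.*-comm (+ 2) (+ m))))

  Zlat-multiplier : ∀ c → 1 ℕ.≤ c → HasMultiplier dot (Zlat (4 ℕ.* m)) (ι (+ c))
  Zlat-multiplier = hasMultiplier lipschitz dot-bilinear quaternion-action (Zlat-subgroup _) (Zlat-signed I₄ₘ)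
      (Zlat-signed J₄ₘ)

  Dlat-multiplier : ∀ c → 1 ℕ.≤ c → HasMultiplier dot (Dlat (4 ℕ.* m)) (ι (+ c))
  Dlat-multiplier = hasMultiplier lipschitz dot-bilinear quaternion-action (Dlat-subgroup _) (Dlat-signed I₄ₘ)
      (Dlat-signed J₄ₘ)

  Dplus-multiplier : ∀ c → 1 ℕ.≤ c → HasMultiplier dot (Dplus (4 ℕ.* m)) (ι (+ c))
  Dplus-multiplier = hasMultiplier lipschitz dot-bilinear quaternion-action
    (Dplus-subgroup (∣-multiple (+ 2) (+ (2 ℕ.* m)) (trans (sym (twice-minus-count I₄ₘ))
      (trans (cong (+ 2 ℤ.*_) (minus-count m I₄ₘ)) (ℤₚ.*-comm (+ 2) (+ (2 ℕ.* m)))))))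
    (Dplus-signed I₄ₘ (minus-count-even I₄ₘ)) (Dplus-signed J₄ₘ (minus-count-even J₄ₘ))

infix 4 _∣?_

_∣?_ : ∀ k i → Dec (k ∣ i)
k ∣? i = ℤ.∣ k ∣ ℕᵈ.∣? ℤ.∣ i ∣

-- A 0-1 matrix given by one number per row, the entries of the row being its binary digits.
bits : ∀ {n r} → Vec ℕ r → Fin r → Fin n → ℤ
bits rows k i = bit (toℕ i) (lookup rows k)

∣-∑ : ∀ {n d} (f : Vecℤ n) → (∀ k → d Signed.∣ f k) → d Signed.∣ ∑ℤ f
∣-∑ {zero} f d∣f = divides (+ 0) refl
∣-∑ {suc n} f d∣f = Signed.∣m∣n⇒∣m+n (d∣f zero) (∣-∑ (f ∘ suc) (d∣f ∘ suc))

∣-resp : ∀ {k x y} → x ≡ y → k Signed.∣ x → k Signed.∣ y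
∣-resp refl k∣x = k∣x

∣-combination : ∀ {r d} (a h : Vecℤ r) → (∀ k → d Signed.∣ h k) → d Signed.∣ ∑ℤ (λ k → a k ℤ.* h k)
∣-combination a h d∣h = ∣-∑ (λ k → a k ℤ.* h k) (λ k → Signed.∣n⇒∣m*n (a k) (d∣h k))

module _ {r n : ℕ} (g : Fin r → Fin n → ℤ) where

  word : Vecℤ r → Fin n → ℤ
  word a i = ∑ℤ (λ k → a k ℤ.* g k i)

  word-+ : ∀ a b i → word (λ k → a k ℤ.+ b k) i ≡ word a i ℤ.+ word b i
  word-+ a b i = trans (∑ℤ.∑-cong (λ k → ℤₚ.*-distribʳ-+ (g k i) (a k) (b k)))
      (∑ℤ.∑-+ (λ k → a k ℤ.* g k i) (λ k → b k ℤ.* g k i))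

  word-* : ∀ m a i → word (λ k → m ℤ.* a k) i ≡ m ℤ.* word a i
  word-* m a i = trans (∑ℤ.∑-cong (λ k → ℤₚ.*-assoc m (a k) (g k i))) (∑ℤ.∑-*ˡ m (λ k → a k ℤ.* g k i))

  record CodeSymmetry (p : SignedPerm n) : Set where
    field
      M : Fin r → Fin r → ℤ
      permuted : ∀ k i → + 2 ∣ g k (π p i) ℤ.- word (M k) i
      orthogonal : ∀ k → + 2 ∣ ∑ℤ (λ i → χ (minus p i) ℤ.* g k i)

decide₂ : ∀ {m n} {P : Fin m → Fin n → Set} (P? : ∀ k i → Dec (P k i)) → {_ : True (Finₚ.all? λ k → Finₚ.all? (P? k))}
    → ∀ k i → P k i
decide₂ P? {w} = toWitness w

module Symmetry {r n : ℕ} {g : Fin r → Fin n → ℤ} {p : SignedPerm n} (sym-g : CodeSymmetry g p) where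
  open CodeSymmetry sym-g
  open ≡-Reasoning

  transport : Vecℤ r → Vecℤ r
  transport a l = ∑ℤ (λ k → a k ℤ.* M k l)

  word-transport : ∀ a i → word g (transport a) i ≡ ∑ℤ (λ k → a k ℤ.* word g (M k) i)
  word-transport a i = begin
    ∑ℤ (λ l → ∑ℤ (λ k → a k ℤ.* M k l) ℤ.* g l i)
      ≡⟨ ∑ℤ.∑-cong (λ l → ∑ℤ.∑-*ʳ (g l i) (λ k → a k ℤ.* M k l)) ⟨
    ∑ℤ (λ l → ∑ℤ (λ k → a k ℤ.* M k l ℤ.* g l i))
      ≡⟨ ∑ℤ.∑-comm (λ l k → a k ℤ.* M k l ℤ.* g l i) ⟩
    ∑ℤ (λ k → ∑ℤ (λ l → a k ℤ.* M k l ℤ.* g l i))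
      ≡⟨ ∑ℤ.∑-cong (λ k → trans (∑ℤ.∑-cong (λ l → ℤₚ.*-assoc (a k) (M k l) (g l i)))
          (∑ℤ.∑-*ˡ (a k) (λ l → M k l ℤ.* g l i))) ⟩
    ∑ℤ (λ k → a k ℤ.* word g (M k) i) ∎

  word-permuted : ∀ a i → + 2 Signed.∣ word g a (π p i) ℤ.- word g (transport a) i
  word-permuted a i = ∣-resp (begin
      ∑ℤ (λ k → a k ℤ.* (g k (π p i) ℤ.- word g (M k) i))
        ≡⟨ ∑ℤ.∑-cong (λ k → solve 3 (λ a x y → a :* (x :- y) := a :* x :+ (:- (a :* y))) refl (a k) (g k (π p i))
            (word g (M k) i)) ⟩
      ∑ℤ (λ k → a k ℤ.* g k (π p i) ℤ.+ ℤ.- (a k ℤ.* word g (M k) i))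
        ≡⟨ ∑ℤ.∑-+ (λ k → a k ℤ.* g k (π p i)) (λ k → ℤ.- (a k ℤ.* word g (M k) i)) ⟩
      word g a (π p i) ℤ.+ ∑ℤ (λ k → ℤ.- (a k ℤ.* word g (M k) i))
        ≡⟨ cong (λ z → word g a (π p i) ℤ.+ z) (trans (∑ℤ-neg (λ k → a k ℤ.* word g (M k) i))
            (cong ℤ.-_ (sym (word-transport a i)))) ⟩
      word g a (π p i) ℤ.- word g (transport a) i ∎)
    (∣-combination a (λ k → g k (π p i) ℤ.- word g (M k) i) (λ k → ∣ᵤ⇒∣ (permuted k i)))
    where open ℤ-Solver

  word-orthogonal : ∀ a → + 2 Signed.∣ ∑ℤ (λ i → χ (minus p i) ℤ.* word g a i)
  word-orthogonal a = ∣-resp (begin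
      ∑ℤ (λ k → a k ℤ.* ∑ℤ (λ i → χ (minus p i) ℤ.* g k i))
        ≡⟨ ∑ℤ.∑-cong (λ k → ∑ℤ.∑-*ˡ (a k) (λ i → χ (minus p i) ℤ.* g k i)) ⟨
      ∑ℤ (λ k → ∑ℤ (λ i → a k ℤ.* (χ (minus p i) ℤ.* g k i)))
        ≡⟨ ∑ℤ.∑-comm (λ k i → a k ℤ.* (χ (minus p i) ℤ.* g k i)) ⟩
      ∑ℤ (λ i → ∑ℤ (λ k → a k ℤ.* (χ (minus p i) ℤ.* g k i)))
        ≡⟨ ∑ℤ.∑-cong (λ i → trans (∑ℤ.∑-cong (λ k → solve 3 (λ a c g → a :* (c :* g) := c :* (a :* g)) refl (a k)
            (χ (minus p i)) (g k i)))
             (∑ℤ.∑-*ˡ (χ (minus p i)) (λ k → a k ℤ.* g k i))) ⟩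
      ∑ℤ (λ i → χ (minus p i) ℤ.* word g a i) ∎)
    (∣-combination a (λ k → ∑ℤ (λ i → χ (minus p i) ℤ.* g k i)) (λ k → ∣ᵤ⇒∣ (orthogonal k)))
    where open ℤ-Solver

  word-orthogonal-permuted : ∀ a → + 2 Signed.∣ ∑ℤ (λ i → χ (minus p i) ℤ.* word g a (π p i))
  word-orthogonal-permuted a = ∣-resp (begin
      ∑ℤ (λ i → χ (minus p i) ℤ.* word g (transport a) i) ℤ.+ ∑ℤ
          (λ i → χ (minus p i) ℤ.* (word g a (π p i) ℤ.- word g (transport a) i))
        ≡⟨ ∑ℤ.∑-+ (λ i → χ (minus p i) ℤ.* word g (transport a) i)
            (λ i → χ (minus p i) ℤ.* (word g a (π p i) ℤ.- word g (transport a) i)) ⟨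
      ∑ℤ (λ i → χ (minus p i) ℤ.* word g (transport a) i ℤ.+ χ (minus p i) ℤ.*
          (word g a (π p i) ℤ.- word g (transport a) i))
        ≡⟨ ∑ℤ.∑-cong (λ i → solve 3 (λ c t w → c :* t :+ c :* (w :- t) := c :* w) refl (χ (minus p i))
            (word g (transport a) i) (word g a (π p i))) ⟩
      ∑ℤ (λ i → χ (minus p i) ℤ.* word g a (π p i)) ∎)
    (Signed.∣m∣n⇒∣m+n (word-orthogonal (transport a)) (∣-∑ _
        (λ i → Signed.∣n⇒∣m*n (χ (minus p i)) (word-permuted a i))))
    where open ℤ-Solver

-- Construction B of Conway–Sloane; codewords are integer vectors read mod 2.
ConstructionB : ∀ {r n} → (Fin r → Fin n → ℤ) → Vecℤ n → Set
ConstructionB {r} g y = Σ (Vecℤ r) λ a → (∀ i → + 2 Signed.∣ y i ℤ.- word g a i) × + 4 Signed.∣ ∑ℤ y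

module _ {r n : ℕ} (g : Fin r → Fin n → ℤ) where
  open ℤ-Solver

  ConstructionB-subgroup : IsSubgroup (IntVecWith (ConstructionB g))
  ConstructionB-subgroup = IntVecWith-subgroup
    (λ {y} {z} → λ (a , y≡ , 4∣y) (b , z≡ , 4∣z) → (λ k → a k ℤ.+ b k)
      , (λ i → ∣-resp (trans (solve 4 (λ y z v w → (y :- v) :+ (z :- w) := (y :+ z) :- (v :+ w)) refl (y i) (z i)
          (word g a i) (word g b i))
            (cong (λ w → y i ℤ.+ z i ℤ.- w) (sym (word-+ g a b i))))
          (Signed.∣m∣n⇒∣m+n (y≡ i) (z≡ i)))
      , ∣-resp (sym (∑ℤ.∑-+ y z)) (Signed.∣m∣n⇒∣m+n 4∣y 4∣z))
    (λ {y} → λ (a , y≡ , 4∣y) → (λ k → ℤ.- + 1 ℤ.* a k)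
      , (λ i → ∣-resp (trans (solve 2 (λ y w → :- (y :- w) := :- y :- con (ℤ.- + 1) :* w) refl (y i) (word g a i))
            (cong (λ w → ℤ.- y i ℤ.- w) (sym (word-* g (ℤ.- + 1) a i))))
          (Signed.∣m⇒∣-m (y≡ i)))
      , ∣-resp (sym (∑ℤ-neg y)) (Signed.∣m⇒∣-m 4∣y))

  ConstructionB-signed : ∀ p → CodeSymmetry g p → Preserves (IntVecWith (ConstructionB g)) (matrix p)
  ConstructionB-signed p sym-g = IntVecWith-signed p (λ {y} (a , y≡ , 4∣y) →
      transport a , congruent y a y≡ , total y 4∣y (negated y a y≡))
    where
    open Symmetry sym-g
    negated : ∀ y a → (∀ i → + 2 Signed.∣ y i ℤ.- word g a i) → + 2 Signed.∣ ∑ℤ (λ i → χ (minus p i) ℤ.* y (π p i))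
    negated y a y≡ = ∣-resp (trans (sym (∑ℤ.∑-+ (λ i → χ (minus p i) ℤ.* word g a (π p i))
        (λ i → χ (minus p i) ℤ.* (y (π p i) ℤ.- word g a (π p i)))))
        (∑ℤ.∑-cong (λ i → solve 3 (λ c w y → c :* w :+ c :* (y :- w) := c :* y) refl (χ (minus p i)) (word g a (π p i))
            (y (π p i)))))
      (Signed.∣m∣n⇒∣m+n (word-orthogonal-permuted a) (∣-∑ _ (λ i → Signed.∣n⇒∣m*n (χ (minus p i)) (y≡ (π p i)))))
    total : ∀ y → + 4 Signed.∣ ∑ℤ y → + 2 Signed.∣ ∑ℤ (λ i → χ (minus p i) ℤ.* y (π p i)) → + 4 Signed.∣ ∑ℤ (signed p y)
    total y (divides s Σy≡) (divides q χy≡) = divides (s ℤ.- q)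
        (trans (signed-sum p y) (trans (cong₂ (λ u v → u ℤ.- + 2 ℤ.* v) Σy≡ χy≡)
      (solve 2 (λ s q → s :* con (+ 4) :- con (+ 2) :* (q :* con (+ 2)) := (s :- q) :* con (+ 4)) refl s q)))
    congruent : ∀ y a → (∀ i → + 2 Signed.∣ y i ℤ.- word g a i) → ∀ i → + 2 Signed.∣ signed p y i ℤ.- word g
        (transport a) i
    congruent y a y≡ i = ∣-resp (solve 4 (λ c y w t → (y :- w) :+ (w :- t) :- (c :* y) :* con (+ 2) :=
        (con (+ 1) :- con (+ 2) :* c) :* y :- t) refl
        (χ (minus p i)) (y (π p i)) (word g a (π p i)) (word g (transport a) i))
      (Signed.∣m∣n⇒∣m-n (Signed.∣m∣n⇒∣m+n (y≡ (π p i)) (word-permuted a i))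
          (divides (χ (minus p i) ℤ.* y (π p i)) refl))

symmetry : ∀ {r n} {g : Fin r → Fin n → ℤ} {p : SignedPerm n} (M : Fin r → Fin r → ℤ) →
  {_ : True (Finₚ.all? λ k → Finₚ.all? λ i → + 2 ∣? (g k (π p i) ℤ.- word g (M k) i))} →
  {_ : True (Finₚ.all? λ k → + 2 ∣? ∑ℤ (λ i → χ (minus p i) ℤ.* g k i))} → CodeSymmetry g p
symmetry M {v} {w} = record { M = M ; permuted = toWitness v ; orthogonal = toWitness w }

transfer : ∀ {n} (ip : Vecℚ n → Vecℚ n → ℚ) (Λ Λ′ : Lattice n) c → (∀ {x} → Λ′ x → Λ x) → (∀ {x} → Λ x → Λ′ x) →
  HasMultiplier ip Λ c → HasMultiplier ip Λ′ c
transfer _ _ _ _ to from (σ , similar , preserves) = σ , similar , λ x x∈ → from (preserves x (to x∈))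

rm-gen : Fin 5 → Fin 16 → ℤ
rm-gen zero i = + 1
rm-gen (suc k) i = bit (toℕ k) (toℕ i)

BWᶜ : Lattice 16
BWᶜ = IntVecWith (ConstructionB rm-gen)

BW16⇒ : ∀ {x} → BW16 x → BWᶜ x
BW16⇒ (y , x≡ , a₀ , a , y≡ , 4∣y) = y , x≡ , (λ { zero → a₀ ; (suc k) → a k })
  , (λ i → ∣-resp (cong (λ z → y i ℤ.- (z ℤ.+ ∑ℤ (λ k → a k ℤ.* bit (toℕ k) (toℕ i)))) (sym (ℤₚ.*-identityʳ a₀)))
      (∣ᵤ⇒∣ (y≡ i)))
  , ∣ᵤ⇒∣ 4∣y

BW16⇐ : ∀ {x} → BWᶜ x → BW16 x
BW16⇐ (y , x≡ , a , y≡ , 4∣y) = y , x≡ , a zero , (λ k → a (suc k))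
  , (λ i → ∣⇒∣ᵤ (∣-resp (cong (λ z → y i ℤ.- (z ℤ.+ ∑ℤ (λ k → a (suc k) ℤ.* bit (toℕ k) (toℕ i))))
      (ℤₚ.*-identityʳ (a zero))) (y≡ i)))
  , ∣⇒∣ᵤ 4∣y

BW-I : CodeSymmetry rm-gen (I₄ₘ 4)
BW-I = symmetry (bits (1 ∷ 2 ∷ 4 ∷ 9 ∷ 16 ∷ []))

BW-J : CodeSymmetry rm-gen (J₄ₘ 4)
BW-J = symmetry (bits (1 ∷ 2 ∷ 4 ∷ 8 ∷ 17 ∷ []))

BW16-multiplier : ∀ c → 1 ℕ.≤ c → HasMultiplier dot BW16 (ι (+ c))
BW16-multiplier c 1≤c = transfer dot BWᶜ BW16 (ι (+ c)) BW16⇒ BW16⇐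
  (hasMultiplier lipschitz dot-bilinear (quaternion-action 4) (ConstructionB-subgroup rm-gen)
    (ConstructionB-signed rm-gen (I₄ₘ 4) BW-I) (ConstructionB-signed rm-gen (J₄ₘ 4) BW-J) c 1≤c)

LeechConstruction : ∀ {r n} → (Fin r → Fin n → ℤ) → Vecℤ n → Set
LeechConstruction {r} g y = Σ ℤ λ m → Σ (Vecℤ r) λ a →
  (∀ i → + 4 Signed.∣ y i ℤ.- (m ℤ.+ + 2 ℤ.* word g a i)) × + 8 Signed.∣ ∑ℤ y ℤ.- + 4 ℤ.* m

module _ {r n : ℕ} (g : Fin r → Fin n → ℤ) where
  open ℤ-Solver

  LeechConstruction-subgroup : IsSubgroup (IntVecWith (LeechConstruction g))
  LeechConstruction-subgroup = IntVecWith-subgroup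
    (λ {y} {z} → λ (m , a , y≡ , 8∣y) (l , b , z≡ , 8∣z) → m ℤ.+ l , (λ k → a k ℤ.+ b k)
      , (λ i → ∣-resp (trans (solve 6 (λ y z m l v w → (y :- (m :+ con (+ 2) :* v)) :+ (z :- (l :+ con (+ 2) :* w))
              := (y :+ z) :- ((m :+ l) :+ con (+ 2) :* (v :+ w))) refl (y i) (z i) m l (word g a i) (word g b i))
            (cong (λ w → y i ℤ.+ z i ℤ.- (m ℤ.+ l ℤ.+ + 2 ℤ.* w)) (sym (word-+ g a b i))))
          (Signed.∣m∣n⇒∣m+n (y≡ i) (z≡ i)))
      , ∣-resp (trans (solve 4 (λ y z m l → (y :- con (+ 4) :* m) :+ (z :- con (+ 4) :* l) := (y :+ z) :- con (+ 4) :*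
          (m :+ l)) refl (∑ℤ y) (∑ℤ z) m l)
            (cong (λ s → s ℤ.- + 4 ℤ.* (m ℤ.+ l)) (sym (∑ℤ.∑-+ y z))))
          (Signed.∣m∣n⇒∣m+n 8∣y 8∣z))
    (λ {y} → λ (m , a , y≡ , 8∣y) → ℤ.- m , (λ k → ℤ.- + 1 ℤ.* a k)
      , (λ i → ∣-resp (trans (solve 3 (λ y m w → :- (y :- (m :+ con (+ 2) :* w)) := :- y :-
          (:- m :+ con (+ 2) :* (con (ℤ.- + 1) :* w))) refl (y i) m (word g a i))
            (cong (λ w → ℤ.- y i ℤ.- (ℤ.- m ℤ.+ + 2 ℤ.* w)) (sym (word-* g (ℤ.- + 1) a i))))
          (Signed.∣m⇒∣-m (y≡ i)))
      , ∣-resp (trans (solve 2 (λ y m → :- (y :- con (+ 4) :* m) := :- y :- con (+ 4) :* (:- m)) refl (∑ℤ y) m)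
            (cong (λ s → s ℤ.- + 4 ℤ.* (ℤ.- m)) (sym (∑ℤ-neg y))))
          (Signed.∣m⇒∣-m 8∣y))

  -- For odd m the sign changes must themselves form a codeword, since - m ≡ m + 2 m (mod 4).
  LeechConstruction-signed : ∀ p → CodeSymmetry g p → (c : Vecℤ r) → (∀ i → + 2 ∣ χ (minus p i) ℤ.- word g c i) →
    + 4 ∣ ∑ℤ (λ i → χ (minus p i)) → Preserves (IntVecWith (LeechConstruction g)) (matrix p)
  LeechConstruction-signed p sym-g c minus≡ 4∣count = IntVecWith-signed p (λ {y} (m , a , y≡ , 8∣y) →
      m , (λ k → transport a k ℤ.+ m ℤ.* c k) , congruent y m a y≡ , total y m 8∣y (negated y m a y≡))
    where
    open Symmetry sym-g
    negated : ∀ y m a → (∀ i → + 4 Signed.∣ y i ℤ.- (m ℤ.+ + 2 ℤ.* word g a i)) → + 4 Signed.∣ ∑ℤ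
        (λ i → χ (minus p i) ℤ.* y (π p i))
    negated y m a y≡ = ∣-resp (begin
        (m ℤ.* ∑ℤ (λ i → b i) ℤ.+ + 2 ℤ.* ∑ℤ (λ i → b i ℤ.* w i)) ℤ.+ ∑ℤ (λ i → b i ℤ.* d i)
          ≡⟨ cong (λ z → z ℤ.+ ∑ℤ (λ i → b i ℤ.* d i)) (cong₂ ℤ._+_ (∑ℤ.∑-*ˡ m b) (∑ℤ.∑-*ˡ (+ 2) (λ i → b i ℤ.* w i))) ⟨
        (∑ℤ (λ i → m ℤ.* b i) ℤ.+ ∑ℤ (λ i → + 2 ℤ.* (b i ℤ.* w i))) ℤ.+ ∑ℤ (λ i → b i ℤ.* d i)
          ≡⟨ cong (λ z → z ℤ.+ ∑ℤ (λ i → b i ℤ.* d i)) (∑ℤ.∑-+ (λ i → m ℤ.* b i) (λ i → + 2 ℤ.* (b i ℤ.* w i))) ⟨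
        ∑ℤ (λ i → m ℤ.* b i ℤ.+ + 2 ℤ.* (b i ℤ.* w i)) ℤ.+ ∑ℤ (λ i → b i ℤ.* d i)
          ≡⟨ ∑ℤ.∑-+ (λ i → m ℤ.* b i ℤ.+ + 2 ℤ.* (b i ℤ.* w i)) (λ i → b i ℤ.* d i) ⟨
        ∑ℤ (λ i → (m ℤ.* b i ℤ.+ + 2 ℤ.* (b i ℤ.* w i)) ℤ.+ b i ℤ.* d i)
          ≡⟨ ∑ℤ.∑-cong (λ i → solve 4 (λ m b w y → (m :* b :+ con (+ 2) :* (b :* w)) :+ b :*
              (y :- (m :+ con (+ 2) :* w)) := b :* y) refl m (b i) (w i) (y (π p i))) ⟩
        ∑ℤ (λ i → b i ℤ.* y (π p i)) ∎)
      (Signed.∣m∣n⇒∣m+n (Signed.∣m∣n⇒∣m+n (Signed.∣n⇒∣m*n m (∣ᵤ⇒∣ 4∣count))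
          (Signed.*-monoʳ-∣ (+ 2) (word-orthogonal-permuted a)))
        (∣-combination b d (λ i → y≡ (π p i))))
      where
      open ≡-Reasoning
      b w d : Vecℤ n
      b i = χ (minus p i)
      w i = word g a (π p i)
      d i = y (π p i) ℤ.- (m ℤ.+ + 2 ℤ.* w i)
    total : ∀ y m → + 8 Signed.∣ ∑ℤ y ℤ.- + 4 ℤ.* m → + 4 Signed.∣ ∑ℤ (λ i → χ (minus p i) ℤ.* y (π p i)) →
      + 8 Signed.∣ ∑ℤ (signed p y) ℤ.- + 4 ℤ.* m
    total y m 8∣y 4∣b = ∣-resp (trans (solve 3 (λ s m b → (s :- con (+ 4) :* m) :- con (+ 2) :* b :=
        (s :- con (+ 2) :* b) :- con (+ 4) :* m) refl
          (∑ℤ y) m (∑ℤ (λ i → χ (minus p i) ℤ.* y (π p i)))) (cong (λ s → s ℤ.- + 4 ℤ.* m) (sym (signed-sum p y))))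
      (Signed.∣m∣n⇒∣m-n 8∣y (Signed.*-monoʳ-∣ (+ 2) 4∣b))
    congruent : ∀ y m a → (∀ i → + 4 Signed.∣ y i ℤ.- (m ℤ.+ + 2 ℤ.* word g a i)) →
      ∀ i → + 4 Signed.∣ signed p y i ℤ.- (m ℤ.+ + 2 ℤ.* word g (λ k → transport a k ℤ.+ m ℤ.* c k) i)
    congruent y m a y≡ i = ∣-resp (trans
        (solve 6 (λ b y m w t v → (y :- (m :+ con (+ 2) :* w)) :+ con (+ 2) :* (w :- t) :- m :* (con (+ 2) :* (b :- v))
            :- con (+ 2) :* b :* (y :- (m :+ con (+ 2) :* w)) :- (b :* w :+ m :* v) :* con (+ 4)
            := (con (+ 1) :- con (+ 2) :* b) :* y :- (m :+ con (+ 2) :* (t :+ m :* v))) refl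
          (χ (minus p i)) (y (π p i)) m (word g a (π p i)) (word g (transport a) i) (word g c i))
        (cong (λ z → signed p y i ℤ.- (m ℤ.+ + 2 ℤ.* z)) (sym (trans (word-+ g (transport a) (λ k → m ℤ.* c k) i)
          (cong (λ z → word g (transport a) i ℤ.+ z) (word-* g m c i))))))
      (Signed.∣m∣n⇒∣m-n (Signed.∣m∣n⇒∣m-n (Signed.∣m∣n⇒∣m-n (Signed.∣m∣n⇒∣m+n (y≡ (π p i))
        (Signed.*-monoʳ-∣ (+ 2) (word-permuted a i)))
        (Signed.∣n⇒∣m*n m (Signed.*-monoʳ-∣ (+ 2) (∣ᵤ⇒∣ {+ 2} (minus≡ i)))))
        (Signed.∣n⇒∣m*n (+ 2 ℤ.* χ (minus p i)) (y≡ (π p i))))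
        (divides (χ (minus p i) ℤ.* word g a (π p i) ℤ.+ m ℤ.* word g c i) refl))

-- The Leech lattice

-- Bit i of row k is coordinate i of the k-th cyclic shift of the extended quadratic-residue word.
qr-rows : Vec ℕ 23
qr-rows = 8729438 ∷ 9070268 ∷ 9751928 ∷ 11115248 ∷ 13841888 ∷ 10906561 ∷ 13424514 ∷ 10071813
  ∷ 11755018 ∷ 15121428 ∷ 13465641 ∷ 10154067 ∷ 11919526 ∷ 15450444 ∷ 14123673 ∷ 11470131
  ∷ 14551654 ∷ 12326093 ∷ 16263578 ∷ 15749941 ∷ 14722667 ∷ 12668119 ∷ 8559023 ∷ []

golay-gen : Fin 23 → Fin 24 → ℤ
golay-gen = bits qr-rows

qr-shift : Fin 23 → Fin 23 → ℤ
qr-shift i j = qr23 ((toℕ i ℕ.+ 23 ℕ.∸ toℕ j) ℕ.% 23)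

golay-gen-finite : ∀ i p k → qr-shift (fromℕ< {toℕ {24} i} p) k ≡ golay-gen k i
golay-gen-finite i p k = trans (decide₂ (λ j k → qr-shift j k ℤ.≟ golay-gen k (Fin.inject₁ j)) (fromℕ< p) k)
  (cong (golay-gen k) (Finₚ.toℕ-injective (trans (Finₚ.toℕ-inject₁ (fromℕ< p)) (Finₚ.toℕ-fromℕ< p))))

golay-gen-infinite : ∀ k → + 2 ∣ ∑ℤ (λ i → qr-shift i k) ℤ.- golay-gen k (# 23)
golay-gen-infinite = toWitness {a? = Finₚ.all? (λ k → + 2 ∣? ∑ℤ (λ i → qr-shift i k) ℤ.- golay-gen k (# 23))} _

difference-of-sums : ∀ {r n} (a : Vecℤ r) (q : Fin n → Fin r → ℤ) (h : Vecℤ r) →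
  ∑ℤ (λ k → a k ℤ.* (∑ℤ (λ i → q i k) ℤ.- h k)) ≡ ∑ℤ (λ i → ∑ℤ (λ k → a k ℤ.* q i k)) ℤ.- ∑ℤ (λ k → a k ℤ.* h k)
difference-of-sums a q h = begin
  ∑ℤ (λ k → a k ℤ.* (∑ℤ (λ i → q i k) ℤ.- h k))
    ≡⟨ ∑ℤ.∑-cong (λ k → trans (solve 3 (λ a x y → a :* (x :- y) := a :* x :+ (:- (a :* y))) refl (a k)
        (∑ℤ (λ i → q i k)) (h k))
         (cong (λ z → z ℤ.- a k ℤ.* h k) (sym (∑ℤ.∑-*ˡ (a k) (λ i → q i k))))) ⟩
  ∑ℤ (λ k → ∑ℤ (λ i → a k ℤ.* q i k) ℤ.- a k ℤ.* h k)
    ≡⟨ ∑ℤ.∑-+ (λ k → ∑ℤ (λ i → a k ℤ.* q i k)) (λ k → ℤ.- (a k ℤ.* h k)) ⟩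
  ∑ℤ (λ k → ∑ℤ (λ i → a k ℤ.* q i k)) ℤ.+ ∑ℤ (λ k → ℤ.- (a k ℤ.* h k))
    ≡⟨ cong₂ ℤ._+_ (∑ℤ.∑-comm (λ k i → a k ℤ.* q i k)) (∑ℤ-neg (λ k → a k ℤ.* h k)) ⟩
  ∑ℤ (λ i → ∑ℤ (λ k → a k ℤ.* q i k)) ℤ.- ∑ℤ (λ k → a k ℤ.* h k) ∎
  where open ≡-Reasoning
        open ℤ-Solver

golayWord≡word : ∀ a i → + 2 Signed.∣ golayWord a i ℤ.- word golay-gen a i
golayWord≡word a i with toℕ i ℕ.<? 23
... | yes p = ∣-resp (sym (ℤₚ.i≡j⇒i-j≡0 (∑ℤ.∑-cong (λ k → cong (λ z → a k ℤ.* z) (golay-gen-finite i p k)))))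
    (divides (+ 0) refl)
... | no p = ∣-resp (trans split (cong (λ j → ∑ℤ (qrWord a) ℤ.- word golay-gen a j) (sym i≡∞)))
    (∣-combination a (λ k → ∑ℤ (λ i → qr-shift i k) ℤ.- golay-gen k (# 23)) (λ k → ∣ᵤ⇒∣ (golay-gen-infinite k)))
  where
  i≡∞ : i ≡ # 23
  i≡∞ = Finₚ.toℕ-injective (ℕₚ.≤-antisym (Finₚ.toℕ≤pred[n] i) (ℕₚ.≮⇒≥ p))
  split = difference-of-sums a qr-shift (λ k → golay-gen k (# 23))

Leechᶜ : Lattice 24
Leechᶜ = IntVecWith (LeechConstruction golay-gen)

replace-word : ∀ y m {v w} → + 2 Signed.∣ v ℤ.- w → + 4 Signed.∣ y ℤ.- (m ℤ.+ + 2 ℤ.* v) → + 4 Signed.∣ y ℤ.-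
    (m ℤ.+ + 2 ℤ.* w)
replace-word y m {v} {w} 2∣ 4∣ = ∣-resp (solve 4 (λ y m v w → (y :- (m :+ con (+ 2) :* v)) :+ con (+ 2) :* (v :- w) :=
    y :- (m :+ con (+ 2) :* w)) refl y m v w)
  (Signed.∣m∣n⇒∣m+n 4∣ (Signed.*-monoʳ-∣ (+ 2) 2∣))
  where open ℤ-Solver

Leech⇒ : ∀ {x} → Leech x → Leechᶜ x
Leech⇒ (y , x≡ , m , a , y≡ , 8∣y) = y , x≡ , m , a , (λ i → replace-word (y i) m (golayWord≡word a i) (∣ᵤ⇒∣ (y≡ i))) ,
    ∣ᵤ⇒∣ 8∣y

Leech⇐ : ∀ {x} → Leechᶜ x → Leech x
Leech⇐ (y , x≡ , m , a , y≡ , 8∣y) = y , x≡ , m , a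
  , (λ i → ∣⇒∣ᵤ (replace-word (y i) m (∣-resp (solve 2 (λ v w → :- (v :- w) := w :- v) refl (golayWord a i)
      (word golay-gen a i))
      (Signed.∣m⇒∣-m (golayWord≡word a i))) (y≡ i))) , ∣⇒∣ᵤ 8∣y
  where open ℤ-Solver

members : ℕ → Fin 24 → Bool
members C i = does (bit (toℕ i) C ℤ.≟ + 1)

-- The involutions x ↦ - 1 / x and x ↦ (x + 2) / (2 x - 1) of the projective line over 𝔽₂₃, with 23 for ∞.
π₁ π₂ : Vec (Fin 24) 24
π₁ = # 23 ∷ # 22 ∷ # 11 ∷ # 15 ∷ # 17 ∷ # 9 ∷ # 19 ∷ # 13 ∷ # 20 ∷ # 5 ∷ # 16 ∷ # 2 ∷ # 21 ∷ # 7 ∷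
  # 18 ∷ # 3 ∷ # 10 ∷ # 4 ∷ # 14 ∷ # 6 ∷ # 8 ∷ # 12 ∷ # 1 ∷ # 0 ∷ []
π₂ = # 21 ∷ # 3 ∷ # 9 ∷ # 1 ∷ # 14 ∷ # 11 ∷ # 7 ∷ # 6 ∷ # 16 ∷ # 2 ∷ # 20 ∷ # 5 ∷ # 23 ∷ # 19 ∷
  # 4 ∷ # 22 ∷ # 8 ∷ # 18 ∷ # 17 ∷ # 13 ∷ # 10 ∷ # 0 ∷ # 15 ∷ # 12 ∷ []

-- The sign changes are two Golay codewords: the residues and ∞ (generator 0), and the sum of the generators given by the
-- binary digits of 796.
golay-I golay-J : SignedPerm 24
golay-I = record { π = lookup π₁ ; minus = members 8729438 ; π-involutive = decide-Fin ; minus-π = decide-Bool }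
golay-J = record { π = lookup π₂ ; minus = members 12288118 ; π-involutive = decide-Fin ; minus-π = decide-Bool }

golay-anticommute : Anticommute golay-I golay-J
golay-anticommute = record { π-comm = decide-Fin ; minus-anti = decide-Bool }

golay-I-symmetry : CodeSymmetry golay-gen golay-I
golay-I-symmetry = symmetry (bits (3188 ∷ 4194305 ∷ 2049 ∷ 32769 ∷ 131073 ∷ 23560 ∷ 524289 ∷ 1354 ∷ 1048577 ∷
  33 ∷ 17796 ∷ 3184 ∷ 2097153 ∷ 129 ∷ 6406 ∷ 9538 ∷ 1025 ∷ 3172 ∷ 16385 ∷ 3124 ∷ 9290 ∷ 19976 ∷ 9544 ∷ []))

golay-J-symmetry : CodeSymmetry golay-gen golay-J
golay-J-symmetry = symmetry (bits (1922 ∷ 4104 ∷ 4608 ∷ 2280 ∷ 3593 ∷ 6144 ∷ 2154 ∷ 4160 ∷ 16666 ∷ 8656 ∷ 9824 ∷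
  2250 ∷ 2282 ∷ 528384 ∷ 4112 ∷ 4198400 ∷ 4352 ∷ 2311 ∷ 135168 ∷ 468 ∷ 5120 ∷ 4097 ∷ 1324 ∷ []))

codeword : ∀ p (c : ℕ) →
  {_ : True (Finₚ.all? λ i → + 2 ∣? (χ (minus p i) ℤ.- word golay-gen (λ k → bit (toℕ k) c) i))} →
  ∀ i → + 2 ∣ χ (minus p i) ℤ.- word golay-gen (λ k → bit (toℕ k) c) i
codeword p c {w} = toWitness w

golay-minus-count : ∀ p → + 4 ∣ ∑ℤ (λ i → χ (minus p i))
golay-minus-count p = subst (+ 4 ∣_) (sym (minus-count 6 p)) (∣-multiple (+ 4) (+ 3) refl)

Leech-multiplier : ∀ c → 1 ℕ.≤ c → HasMultiplier dot Leech (ι (+ c))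
Leech-multiplier c 1≤c = transfer dot Leechᶜ Leech (ι (+ c)) Leech⇒ Leech⇐
  (hasMultiplier lipschitz dot-bilinear (signed-action golay-anticommute) (LeechConstruction-subgroup golay-gen)
    (LeechConstruction-signed golay-gen golay-I golay-I-symmetry (λ k → bit (toℕ k) 1) (codeword golay-I 1)
        (golay-minus-count golay-I))
    (LeechConstruction-signed golay-gen golay-J golay-J-symmetry (λ k → bit (toℕ k) 796) (codeword golay-J 796)
        (golay-minus-count golay-J))
    c 1≤c)

-- The Coxeter–Todd lattice

ω-entry : Fin 2 → Fin 2 → ℚ
ω-entry zero zero = 0ℚ
ω-entry zero (suc zero) = ℚ.- 1ℚ
ω-entry (suc zero) zero = 1ℚ
ω-entry (suc zero) (suc zero) = ℚ.- 1ℚ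

ω-matrix : Mat 12
ω-matrix i j with remQuot {6} 2 i | remQuot {6} 2 j
... | k , a | l , b = if does (k ≟ l) then ω-entry a b else 0ℚ

⅓ : ℚ
⅓ = + 1 ℚ./ 3

-- twisted e is z ↦ ω^e z̄ / θ in the basis (1 , ω), so that J-matrix is (x , y) ↦ (A ȳ / θ , - A x̄ / θ) on 𝓔³ × 𝓔³ with
-- the Fourier matrix A = (ω^(r s)).
twisted : ℕ → Vec (Vec ℚ 2) 2
twisted 0 = ((ℚ.- ⅓) ∷ (ℚ.- ⅓) ∷ []) ∷ ((ℚ.- (⅓ ℚ.+ ⅓)) ∷ ⅓ ∷ []) ∷ []
twisted 1 = ((⅓ ℚ.+ ⅓) ∷ (ℚ.- ⅓) ∷ []) ∷ (⅓ ∷ (ℚ.- (⅓ ℚ.+ ⅓)) ∷ []) ∷ []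
twisted _ = ((ℚ.- ⅓) ∷ (⅓ ℚ.+ ⅓) ∷ []) ∷ (⅓ ∷ ⅓ ∷ []) ∷ []

j-entry : Fin 2 × Fin 3 → Fin 2 × Fin 3 → Fin 2 → Fin 2 → ℚ
j-entry (zero , r) (suc zero , s) a b = lookup (lookup (twisted ((toℕ r ℕ.* toℕ s) ℕ.% 3)) a) b
j-entry (suc zero , r) (zero , s) a b = ℚ.- lookup (lookup (twisted ((toℕ r ℕ.* toℕ s) ℕ.% 3)) a) b
j-entry _ _ a b = 0ℚ

J-matrix : Mat 12
J-matrix i j with remQuot {6} 2 i | remQuot {6} 2 j
... | k , a | l , b = j-entry (remQuot {2} 3 k) (remQuot {2} 3 l) a b

_ᵀ : ∀ {n} → Mat n → Mat n
(A ᵀ) i j = A j i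

adjoint : ∀ {n} (A : Mat n) u v → dot (apply A u) v ≡ dot u (apply (A ᵀ) v)
adjoint A u v = begin
  ∑ℚ (λ i → ∑ℚ (λ j → A i j ℚ.* u j) ℚ.* v i)
    ≡⟨ ∑ℚ.∑-cong (λ i → ∑ℚ.∑-*ʳ (v i) (λ j → A i j ℚ.* u j)) ⟨
  ∑ℚ (λ i → ∑ℚ (λ j → A i j ℚ.* u j ℚ.* v i))
    ≡⟨ ∑ℚ.∑-comm (λ i j → A i j ℚ.* u j ℚ.* v i) ⟩
  ∑ℚ (λ j → ∑ℚ (λ i → A i j ℚ.* u j ℚ.* v i))
    ≡⟨ ∑ℚ.∑-cong (λ j → trans (∑ℚ.∑-cong (λ i → solve 3 (λ a u v → a :* u :* v := u :* (a :* v)) refl (A i j) (u j)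
        (v i)))
         (∑ℚ.∑-*ˡ (u j) (λ i → A i j ℚ.* v i))) ⟩
  ∑ℚ (λ j → u j ℚ.* ∑ℚ (λ i → A i j ℚ.* v i)) ∎
  where open ≡-Reasoning
        open ℚ-Solver

apply-linear₂ : ∀ {n} {A : Mat n} b (B : Mat n) c (C : Mat n) → (∀ i j → A i j ≡ b ℚ.* B i j ℚ.+ c ℚ.* C i j) →
  ∀ x i → apply A x i ≡ b ℚ.* apply B x i ℚ.+ c ℚ.* apply C x i
apply-linear₂ {A = A} b B c C A≡ x i = begin
  ∑ℚ (λ j → A i j ℚ.* x j)
    ≡⟨ ∑ℚ.∑-cong (λ j → trans (cong (ℚ._* x j) (A≡ i j)) (solve 5
        (λ b c p q x → (b :* p :+ c :* q) :* x := b :* (p :* x) :+ c :* (q :* x)) refl b c (B i j) (C i j) (x j))) ⟩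
  ∑ℚ (λ j → b ℚ.* (B i j ℚ.* x j) ℚ.+ c ℚ.* (C i j ℚ.* x j))
    ≡⟨ ∑ℚ.∑-+ (λ j → b ℚ.* (B i j ℚ.* x j)) (λ j → c ℚ.* (C i j ℚ.* x j)) ⟩
  ∑ℚ (λ j → b ℚ.* (B i j ℚ.* x j)) ℚ.+ ∑ℚ (λ j → c ℚ.* (C i j ℚ.* x j))
    ≡⟨ cong₂ ℚ._+_ (∑ℚ.∑-*ˡ b (λ j → B i j ℚ.* x j)) (∑ℚ.∑-*ˡ c (λ j → C i j ℚ.* x j)) ⟩
  b ℚ.* apply B x i ℚ.+ c ℚ.* apply C x i ∎
  where open ≡-Reasoning
        open ℚ-Solver

apply-scaled : ∀ {n} {A : Mat n} b (B : Mat n) → (∀ i j → A i j ≡ b ℚ.* B i j) → ∀ x i → apply A x i ≡ b ℚ.* apply B x i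
apply-scaled {A = A} b B A≡ x i = trans (∑ℚ.∑-cong (λ j → trans (cong (ℚ._* x j) (A≡ i j))
    (ℚₚ.*-assoc b (B i j) (x j))))
  (∑ℚ.∑-*ˡ b (λ j → B i j ℚ.* x j))

matrix-action : ∀ {n} (G : Form n) (t : ℚ) (I J : Mat n) →
  (∀ i j → (I ∙ I) i j ≡ ℚ.- t ℚ.* I i j ℚ.+ ℚ.- 1ℚ ℚ.* Identity i j) →
  (∀ i j → (J ∙ J) i j ≡ ℚ.- 1ℚ ℚ.* Identity i j) →
  (∀ i j → (I ∙ J) i j ≡ ℚ.- 1ℚ ℚ.* (J ∙ I) i j ℚ.+ ℚ.- t ℚ.* J i j) →
  (∀ i j → ((I ᵀ) ∙ G) i j ≡ ℚ.- t ℚ.* G i j ℚ.+ ℚ.- 1ℚ ℚ.* (G ∙ I) i j) →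
  (∀ i j → ((J ᵀ) ∙ G) i j ≡ ℚ.- 1ℚ ℚ.* (G ∙ J) i j) →
  QuaternionAction (inner G) t
matrix-action {n} G t I J I² J² IJ I-skew J-skew = record
  { I = I
  ; J = J
  ; I² = λ x i → trans (sym (apply-∙ I I x i)) (trans (apply-linear₂ (ℚ.- t) I (ℚ.- 1ℚ) Identity I² x i)
      (cong (λ z → ℚ.- t ℚ.* apply I x i ℚ.+ ℚ.- 1ℚ ℚ.* z) (apply-Identity x i)))
  ; J² = λ x i → trans (sym (apply-∙ J J x i)) (trans (apply-scaled (ℚ.- 1ℚ) Identity J² x i)
      (cong (ℚ.- 1ℚ ℚ.*_) (apply-Identity x i)))
  ; IJ = λ x i → trans (sym (apply-∙ I J x i)) (trans (apply-linear₂ (ℚ.- 1ℚ) (J ∙ I) (ℚ.- t) J IJ x i)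
      (cong (λ z → ℚ.- 1ℚ ℚ.* z ℚ.+ ℚ.- t ℚ.* apply J x i) (apply-∙ J I x i)))
  ; I-skew = λ u v → begin
      inner G (apply I u) v ≡⟨ move I u v ⟩
      dot u (apply ((I ᵀ) ∙ G) v) ≡⟨ ip-cong {u} (λ _ → refl) (apply-linear₂ (ℚ.- t) G (ℚ.- 1ℚ) (G ∙ I) I-skew v) ⟩
      dot u (ℚ.- t ⊙ apply G v ⊕ ℚ.- 1ℚ ⊙ apply (G ∙ I) v)
        ≡⟨ ip-⊕ʳ u (ℚ.- t ⊙ apply G v) (ℚ.- 1ℚ ⊙ apply (G ∙ I) v) ⟩
      dot u (ℚ.- t ⊙ apply G v) ℚ.+ dot u (ℚ.- 1ℚ ⊙ apply (G ∙ I) v)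
        ≡⟨ cong₂ ℚ._+_ (ip-⊙ʳ (ℚ.- t) u (apply G v)) (ip-⊙ʳ (ℚ.- 1ℚ) u (apply (G ∙ I) v)) ⟩
      ℚ.- t ℚ.* dot u (apply G v) ℚ.+ ℚ.- 1ℚ ℚ.* dot u (apply (G ∙ I) v)
        ≡⟨ cong₂ (λ y z → ℚ.- t ℚ.* y ℚ.+ ℚ.- 1ℚ ℚ.* z) (sym (inner-dot G u v)) (unmove I u v) ⟩
      ℚ.- t ℚ.* inner G u v ℚ.+ ℚ.- 1ℚ ℚ.* inner G u (apply I v) ∎
  ; J-skew = λ u v → begin
      inner G (apply J u) v ≡⟨ move J u v ⟩
      dot u (apply ((J ᵀ) ∙ G) v) ≡⟨ ip-cong {u} (λ _ → refl) (apply-scaled (ℚ.- 1ℚ) (G ∙ J) J-skew v) ⟩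
      dot u (ℚ.- 1ℚ ⊙ apply (G ∙ J) v) ≡⟨ ip-⊙ʳ (ℚ.- 1ℚ) u (apply (G ∙ J) v) ⟩
      ℚ.- 1ℚ ℚ.* dot u (apply (G ∙ J) v) ≡⟨ cong (ℚ.- 1ℚ ℚ.*_) (unmove J u v) ⟩
      ℚ.- 1ℚ ℚ.* inner G u (apply J v) ∎
  }
  where
  open ≡-Reasoning
  open Bilinear (dot-bilinear {n})
  move : ∀ A u v → inner G (apply A u) v ≡ dot u (apply ((A ᵀ) ∙ G) v)
  move A u v = trans (inner-dot G (apply A u) v) (trans (adjoint A u (apply G v))
      (ip-cong {u} (λ _ → refl) (λ i → sym (apply-∙ (A ᵀ) G v i))))
  unmove : ∀ A u v → dot u (apply (G ∙ A) v) ≡ inner G u (apply A v)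
  unmove A u v = trans (ip-cong {u} (λ _ → refl) (apply-∙ G A v)) (sym (inner-dot G u (apply A v)))

K12-action : QuaternionAction K12inner (ι (+ 1))
K12-action = matrix-action K12form 1ℚ ω-matrix J-matrix
  (decide₂ (λ i j → (ω-matrix ∙ ω-matrix) i j ℚₚ.≟ ℚ.- 1ℚ ℚ.* ω-matrix i j ℚ.+ ℚ.- 1ℚ ℚ.* Identity i j))
  (decide₂ (λ i j → (J-matrix ∙ J-matrix) i j ℚₚ.≟ ℚ.- 1ℚ ℚ.* Identity i j))
  (decide₂ (λ i j → (ω-matrix ∙ J-matrix) i j ℚₚ.≟ ℚ.- 1ℚ ℚ.* (J-matrix ∙ ω-matrix) i j ℚ.+ ℚ.- 1ℚ ℚ.* J-matrix i j))
  (decide₂ (λ i j → ((ω-matrix ᵀ) ∙ K12form) i j ℚₚ.≟ ℚ.- 1ℚ ℚ.* K12form i j ℚ.+ ℚ.- 1ℚ ℚ.* (K12form ∙ ω-matrix) i j))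
  (decide₂ (λ i j → ((J-matrix ᵀ) ∙ K12form) i j ℚₚ.≟ ℚ.- 1ℚ ℚ.* (K12form ∙ J-matrix) i j))

subgroup-∑ : ∀ {n r} {Λ : Lattice n} → IsSubgroup Λ → (v : Fin (suc r) → Vecℚ n) → (∀ k → Λ (v k)) → (c : Vecℤ (suc r))
    →
  Λ (λ i → ∑ℚ (λ k → ι (c k) ℚ.* v k i))
subgroup-∑ {r = zero} sub v v∈ c = respects (λ i → sym (ℚₚ.+-identityʳ (ι (c zero) ℚ.* v zero i)))
    (ι-closed (c zero) (v∈ zero))
  where open IsSubgroup sub
subgroup-∑ {r = suc r} sub v v∈ c = ⊕-closed (ι-closed (c zero) (v∈ zero))
    (subgroup-∑ sub (v ∘ suc) (v∈ ∘ suc) (c ∘ suc))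
  where open IsSubgroup sub

apply-∑ : ∀ {n r} (A : Mat n) (c : Fin r → ℚ) (v : Fin r → Vecℚ n) i →
  apply A (λ j → ∑ℚ (λ k → c k ℚ.* v k j)) i ≡ ∑ℚ (λ k → c k ℚ.* apply A (v k) i)
apply-∑ A c v i = begin
  ∑ℚ (λ j → A i j ℚ.* ∑ℚ (λ k → c k ℚ.* v k j))
    ≡⟨ ∑ℚ.∑-cong (λ j → ∑ℚ.∑-*ˡ (A i j) (λ k → c k ℚ.* v k j)) ⟨
  ∑ℚ (λ j → ∑ℚ (λ k → A i j ℚ.* (c k ℚ.* v k j)))
    ≡⟨ ∑ℚ.∑-comm (λ j k → A i j ℚ.* (c k ℚ.* v k j)) ⟩
  ∑ℚ (λ k → ∑ℚ (λ j → A i j ℚ.* (c k ℚ.* v k j)))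
    ≡⟨ ∑ℚ.∑-cong (λ k → Bilinear.ip-⊙ʳ dot-bilinear (c k) (A i) (v k)) ⟩
  ∑ℚ (λ k → c k ℚ.* apply A (v k) i) ∎
  where open ≡-Reasoning

∑ι : ∀ {r} (c b : Vecℤ r) → ι (∑ℤ (λ k → c k ℤ.* b k)) ≡ ∑ℚ (λ k → ι (c k) ℚ.* ι (b k))
∑ι {zero} c b = refl
∑ι {suc r} c b = trans (ι-+ (c zero ℤ.* b zero) (∑ℤ (λ k → c (suc k) ℤ.* b (suc k))))
    (cong₂ ℚ._+_ (ι-* (c zero) (b zero)) (∑ι (c ∘ suc) (b ∘ suc)))

preserves-span : ∀ {n r} {P : Vecℤ n → Set} → IsSubgroup (IntVecWith P) → (b : Fin (suc r) → Vecℤ n) →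
  (∀ {y} → P y → ∃ λ c → ∀ i → y i ≡ ∑ℤ (λ k → c k ℤ.* b k i)) →
  (A : Mat n) → (∀ k → IntVecWith P (apply A (ι ∘ b k))) → Preserves (IntVecWith P) A
preserves-span sub b span A A∈ x (y , x≡ , Py) with c , y≡ ← span Py =
  respects (λ i → sym (trans (apply-cong A (λ j → trans (x≡ j) (trans (cong ι (y≡ j)) (∑ι c (λ k → b k j)))) i)
      (apply-∑ A (ι ∘ c) (λ k → ι ∘ b k) i)))
    (subgroup-∑ sub (λ k → apply A (ι ∘ b k)) A∈ c)
  where open IsSubgroup sub

residue-gap : Vecℤ 12 → Fin 6 → Fin 6 → ℤ
residue-gap y k l = (coordA y k ℤ.+ coordB y k) ℤ.- (coordA y l ℤ.+ coordB y l)

K12-condition : Vecℤ 12 → Set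
K12-condition y = (∀ k l → + 3 ∣ residue-gap y k l)
  × (+ 3 ∣ ∑ℤ (coordA y)) × (+ 3 ∣ ∑ℤ (coordB y))

K12-condition? : ∀ y → Dec (K12-condition y)
K12-condition? y = Finₚ.all? (λ k → Finₚ.all? λ l → + 3 ∣? residue-gap y k l)
  ×-dec (+ 3 ∣? ∑ℤ (coordA y)) ×-dec (+ 3 ∣? ∑ℤ (coordB y))

K12-subgroup : IsSubgroup K12
K12-subgroup = IntVecWith-subgroup
  (λ {y} {z} → λ (y≡ , 3∣a , 3∣b) (z≡ , 3∣a′ , 3∣b′) →
    (λ k l → subst (+ 3 ∣_) (shuffle-+ (coordA y k) (coordB y k) (coordA y l) (coordB y l) (coordA z k) (coordB z k)
        (coordA z l) (coordB z l))
      (∣-+ (+ 3) (residue-gap y k l) (residue-gap z k l) (y≡ k l) (z≡ k l)))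
    , ∣-∑-+ (+ 3) (coordA y) (coordA z) 3∣a 3∣a′ , ∣-∑-+ (+ 3) (coordB y) (coordB z) 3∣b 3∣b′)
  (λ {y} → λ (y≡ , 3∣a , 3∣b) →
    (λ k l → subst (+ 3 ∣_) (shuffle-neg (coordA y k) (coordB y k) (coordA y l) (coordB y l))
        (∣-neg (+ 3) (residue-gap y k l) (y≡ k l)))
    , ∣-∑-neg (+ 3) (coordA y) 3∣a , ∣-∑-neg (+ 3) (coordB y) 3∣b)
  where
  open ℤ-Solver
  shuffle-+ : ∀ a b c d e f g h → ((a ℤ.+ b) ℤ.- (c ℤ.+ d)) ℤ.+ ((e ℤ.+ f) ℤ.- (g ℤ.+ h)) ≡ ((a ℤ.+ e) ℤ.+ (b ℤ.+ f))
      ℤ.- ((c ℤ.+ g) ℤ.+ (d ℤ.+ h))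
  shuffle-+ = solve 8 (λ a b c d e f g h → ((a :+ b) :- (c :+ d)) :+ ((e :+ f) :- (g :+ h)) := ((a :+ e) :+ (b :+ f))
      :- ((c :+ g) :+ (d :+ h))) refl
  shuffle-neg : ∀ a b c d → ℤ.- ((a ℤ.+ b) ℤ.- (c ℤ.+ d)) ≡ (ℤ.- a ℤ.+ ℤ.- b) ℤ.- (ℤ.- c ℤ.+ ℤ.- d)
  shuffle-neg = solve 4 (λ a b c d → :- ((a :+ b) :- (c :+ d)) := (:- a :+ :- b) :- (:- c :+ :- d)) refl

-- A vector of K₁₂ is determined by a₀ , … , a₄ , b₀ and the quotients A = Σ aₖ / 3 and
-- qₖ = ((aₖ + bₖ) - (a₀ + b₀)) / 3; row i expresses the i-th coordinate in a₀ , … , a₄ , A , b₀ , q₁ , … , q₅.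
K12-rows : Vec (Vec ℤ 12) 12
K12-rows = (+ 1 ∷ + 0 ∷ + 0 ∷ + 0 ∷ + 0 ∷ + 0 ∷ + 0 ∷ + 0 ∷ + 0 ∷ + 0 ∷ + 0 ∷ + 0 ∷ []) ∷
  (+ 0 ∷ + 0 ∷ + 0 ∷ + 0 ∷ + 0 ∷ + 0 ∷ + 1 ∷ + 0 ∷ + 0 ∷ + 0 ∷ + 0 ∷ + 0 ∷ []) ∷
  (+ 0 ∷ + 1 ∷ + 0 ∷ + 0 ∷ + 0 ∷ + 0 ∷ + 0 ∷ + 0 ∷ + 0 ∷ + 0 ∷ + 0 ∷ + 0 ∷ []) ∷
  (+ 1 ∷ -[1+ 0 ] ∷ + 0 ∷ + 0 ∷ + 0 ∷ + 0 ∷ + 1 ∷ + 3 ∷ + 0 ∷ + 0 ∷ + 0 ∷ + 0 ∷ []) ∷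
  (+ 0 ∷ + 0 ∷ + 1 ∷ + 0 ∷ + 0 ∷ + 0 ∷ + 0 ∷ + 0 ∷ + 0 ∷ + 0 ∷ + 0 ∷ + 0 ∷ []) ∷
  (+ 1 ∷ + 0 ∷ -[1+ 0 ] ∷ + 0 ∷ + 0 ∷ + 0 ∷ + 1 ∷ + 0 ∷ + 3 ∷ + 0 ∷ + 0 ∷ + 0 ∷ []) ∷
  (+ 0 ∷ + 0 ∷ + 0 ∷ + 1 ∷ + 0 ∷ + 0 ∷ + 0 ∷ + 0 ∷ + 0 ∷ + 0 ∷ + 0 ∷ + 0 ∷ []) ∷
  (+ 1 ∷ + 0 ∷ + 0 ∷ -[1+ 0 ] ∷ + 0 ∷ + 0 ∷ + 1 ∷ + 0 ∷ + 0 ∷ + 3 ∷ + 0 ∷ + 0 ∷ []) ∷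
  (+ 0 ∷ + 0 ∷ + 0 ∷ + 0 ∷ + 1 ∷ + 0 ∷ + 0 ∷ + 0 ∷ + 0 ∷ + 0 ∷ + 0 ∷ + 0 ∷ []) ∷
  (+ 1 ∷ + 0 ∷ + 0 ∷ + 0 ∷ -[1+ 0 ] ∷ + 0 ∷ + 1 ∷ + 0 ∷ + 0 ∷ + 0 ∷ + 3 ∷ + 0 ∷ []) ∷
  (-[1+ 0 ] ∷ -[1+ 0 ] ∷ -[1+ 0 ] ∷ -[1+ 0 ] ∷ -[1+ 0 ] ∷ + 3 ∷ + 0 ∷ + 0 ∷ + 0 ∷ + 0 ∷ + 0 ∷ + 0 ∷ []) ∷
  (+ 2 ∷ + 1 ∷ + 1 ∷ + 1 ∷ + 1 ∷ -[1+ 2 ] ∷ + 1 ∷ + 0 ∷ + 0 ∷ + 0 ∷ + 0 ∷ + 3 ∷ []) ∷ []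

K12-basis : Fin 12 → Vecℤ 12
K12-basis k i = lookup (lookup K12-rows i) k

K12-span : ∀ {y} → K12-condition y → ∃ λ c → ∀ i → y i ≡ ∑ℤ (λ k → c k ℤ.* K12-basis k i)
K12-span {y} (y≡ , 3∣a , _) = lookup coefficients , coordinate
  where
  open ℤ-Solver
  a b q : Fin 6 → ℤ
  a = coordA y
  b = coordB y
  A : ℤ
  A = Signed.quotient (∣ᵤ⇒∣ {+ 3} {∑ℤ a} 3∣a)
  q k = Signed.quotient (∣ᵤ⇒∣ {+ 3} {residue-gap y k 0F} (y≡ k 0F))
  coefficients : Vec ℤ 12
  coefficients = a 0F ∷ a 1F ∷ a 2F ∷ a 3F ∷ a 4F ∷ A ∷ b 0F ∷ q 1F ∷ q 2F ∷ q 3F ∷ q 4F ∷ q 5F ∷ []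
  a₅≡ : a 5F ≡ A ℤ.* + 3 ℤ.- (a 0F ℤ.+ a 1F ℤ.+ a 2F ℤ.+ a 3F ℤ.+ a 4F)
  a₅≡ = trans (solve 6 (λ a₀ a₁ a₂ a₃ a₄ a₅ → a₅ := (a₀ :+ (a₁ :+ (a₂ :+ (a₃ :+ (a₄ :+ (a₅ :+ con (+ 0))))))) :-
      (a₀ :+ a₁ :+ a₂ :+ a₃ :+ a₄)) refl
      (a 0F) (a 1F) (a 2F) (a 3F) (a 4F) (a 5F))
    (cong (λ z → z ℤ.- (a 0F ℤ.+ a 1F ℤ.+ a 2F ℤ.+ a 3F ℤ.+ a 4F)) (Signed._∣_.equality (∣ᵤ⇒∣ {+ 3} {∑ℤ a} 3∣a)))
  b≡ : ∀ k → b k ≡ q k ℤ.* + 3 ℤ.+ (a 0F ℤ.+ b 0F) ℤ.- a k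
  b≡ k = trans (solve 4 (λ a₀ b₀ a b → b := ((a :+ b) :- (a₀ :+ b₀)) :+ (a₀ :+ b₀) :- a) refl (a 0F) (b 0F) (a k) (b k))
    (cong (λ z → z ℤ.+ (a 0F ℤ.+ b 0F) ℤ.- a k) (Signed._∣_.equality (∣ᵤ⇒∣ {+ 3} {residue-gap y k 0F} (y≡ k 0F))))
  rowᴾ : ∀ {m n} → Vec ℤ n → Vec (Polynomial m) n → Polynomial m
  rowᴾ [] [] = con (+ 0)
  rowᴾ (c ∷ cs) (v ∷ vs) = v :* con c :+ rowᴾ cs vs
  coordinate : ∀ i → y i ≡ ∑ℤ (λ k → lookup coefficients k ℤ.* K12-basis k i)
  coordinate 0F = solve 12 (λ a₀ a₁ a₂ a₃ a₄ A b₀ q₁ q₂ q₃ q₄ q₅ → a₀ := rowᴾ (lookup K12-rows 0F)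
      (a₀ ∷ a₁ ∷ a₂ ∷ a₃ ∷ a₄ ∷ A ∷ b₀ ∷ q₁ ∷ q₂ ∷ q₃ ∷ q₄ ∷ q₅ ∷ [])) refl
    (a 0F) (a 1F) (a 2F) (a 3F) (a 4F) A (b 0F) (q 1F) (q 2F) (q 3F) (q 4F) (q 5F)
  coordinate 1F = solve 12 (λ a₀ a₁ a₂ a₃ a₄ A b₀ q₁ q₂ q₃ q₄ q₅ → b₀ := rowᴾ (lookup K12-rows 1F)
      (a₀ ∷ a₁ ∷ a₂ ∷ a₃ ∷ a₄ ∷ A ∷ b₀ ∷ q₁ ∷ q₂ ∷ q₃ ∷ q₄ ∷ q₅ ∷ [])) refl
    (a 0F) (a 1F) (a 2F) (a 3F) (a 4F) A (b 0F) (q 1F) (q 2F) (q 3F) (q 4F) (q 5F)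
  coordinate 2F = solve 12 (λ a₀ a₁ a₂ a₃ a₄ A b₀ q₁ q₂ q₃ q₄ q₅ → a₁ := rowᴾ (lookup K12-rows 2F)
      (a₀ ∷ a₁ ∷ a₂ ∷ a₃ ∷ a₄ ∷ A ∷ b₀ ∷ q₁ ∷ q₂ ∷ q₃ ∷ q₄ ∷ q₅ ∷ [])) refl
    (a 0F) (a 1F) (a 2F) (a 3F) (a 4F) A (b 0F) (q 1F) (q 2F) (q 3F) (q 4F) (q 5F)
  coordinate 3F = trans (b≡ 1F) (solve 12 (λ a₀ a₁ a₂ a₃ a₄ A b₀ q₁ q₂ q₃ q₄ q₅ → q₁ :* con (+ 3) :+ (a₀ :+ b₀) :- a₁
      := rowᴾ (lookup K12-rows 3F) (a₀ ∷ a₁ ∷ a₂ ∷ a₃ ∷ a₄ ∷ A ∷ b₀ ∷ q₁ ∷ q₂ ∷ q₃ ∷ q₄ ∷ q₅ ∷ [])) refl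
    (a 0F) (a 1F) (a 2F) (a 3F) (a 4F) A (b 0F) (q 1F) (q 2F) (q 3F) (q 4F) (q 5F))
  coordinate 4F = solve 12 (λ a₀ a₁ a₂ a₃ a₄ A b₀ q₁ q₂ q₃ q₄ q₅ → a₂ := rowᴾ (lookup K12-rows 4F)
      (a₀ ∷ a₁ ∷ a₂ ∷ a₃ ∷ a₄ ∷ A ∷ b₀ ∷ q₁ ∷ q₂ ∷ q₃ ∷ q₄ ∷ q₅ ∷ [])) refl
    (a 0F) (a 1F) (a 2F) (a 3F) (a 4F) A (b 0F) (q 1F) (q 2F) (q 3F) (q 4F) (q 5F)
  coordinate 5F = trans (b≡ 2F) (solve 12 (λ a₀ a₁ a₂ a₃ a₄ A b₀ q₁ q₂ q₃ q₄ q₅ → q₂ :* con (+ 3) :+ (a₀ :+ b₀) :- a₂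
      := rowᴾ (lookup K12-rows 5F) (a₀ ∷ a₁ ∷ a₂ ∷ a₃ ∷ a₄ ∷ A ∷ b₀ ∷ q₁ ∷ q₂ ∷ q₃ ∷ q₄ ∷ q₅ ∷ [])) refl
    (a 0F) (a 1F) (a 2F) (a 3F) (a 4F) A (b 0F) (q 1F) (q 2F) (q 3F) (q 4F) (q 5F))
  coordinate 6F = solve 12 (λ a₀ a₁ a₂ a₃ a₄ A b₀ q₁ q₂ q₃ q₄ q₅ → a₃ := rowᴾ (lookup K12-rows 6F)
      (a₀ ∷ a₁ ∷ a₂ ∷ a₃ ∷ a₄ ∷ A ∷ b₀ ∷ q₁ ∷ q₂ ∷ q₃ ∷ q₄ ∷ q₅ ∷ [])) refl
    (a 0F) (a 1F) (a 2F) (a 3F) (a 4F) A (b 0F) (q 1F) (q 2F) (q 3F) (q 4F) (q 5F)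
  coordinate 7F = trans (b≡ 3F) (solve 12 (λ a₀ a₁ a₂ a₃ a₄ A b₀ q₁ q₂ q₃ q₄ q₅ → q₃ :* con (+ 3) :+ (a₀ :+ b₀) :- a₃
      := rowᴾ (lookup K12-rows 7F) (a₀ ∷ a₁ ∷ a₂ ∷ a₃ ∷ a₄ ∷ A ∷ b₀ ∷ q₁ ∷ q₂ ∷ q₃ ∷ q₄ ∷ q₅ ∷ [])) refl
    (a 0F) (a 1F) (a 2F) (a 3F) (a 4F) A (b 0F) (q 1F) (q 2F) (q 3F) (q 4F) (q 5F))
  coordinate 8F = solve 12 (λ a₀ a₁ a₂ a₃ a₄ A b₀ q₁ q₂ q₃ q₄ q₅ → a₄ := rowᴾ (lookup K12-rows 8F)
      (a₀ ∷ a₁ ∷ a₂ ∷ a₃ ∷ a₄ ∷ A ∷ b₀ ∷ q₁ ∷ q₂ ∷ q₃ ∷ q₄ ∷ q₅ ∷ [])) refl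
    (a 0F) (a 1F) (a 2F) (a 3F) (a 4F) A (b 0F) (q 1F) (q 2F) (q 3F) (q 4F) (q 5F)
  coordinate 9F = trans (b≡ 4F) (solve 12 (λ a₀ a₁ a₂ a₃ a₄ A b₀ q₁ q₂ q₃ q₄ q₅ → q₄ :* con (+ 3) :+ (a₀ :+ b₀) :- a₄
      := rowᴾ (lookup K12-rows 9F) (a₀ ∷ a₁ ∷ a₂ ∷ a₃ ∷ a₄ ∷ A ∷ b₀ ∷ q₁ ∷ q₂ ∷ q₃ ∷ q₄ ∷ q₅ ∷ [])) refl
    (a 0F) (a 1F) (a 2F) (a 3F) (a 4F) A (b 0F) (q 1F) (q 2F) (q 3F) (q 4F) (q 5F))
  coordinate (suc 9F) = trans a₅≡ (solve 12 (λ a₀ a₁ a₂ a₃ a₄ A b₀ q₁ q₂ q₃ q₄ q₅ → A :* con (+ 3) :-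
      (a₀ :+ a₁ :+ a₂ :+ a₃ :+ a₄) := rowᴾ (lookup K12-rows (suc 9F))
      (a₀ ∷ a₁ ∷ a₂ ∷ a₃ ∷ a₄ ∷ A ∷ b₀ ∷ q₁ ∷ q₂ ∷ q₃ ∷ q₄ ∷ q₅ ∷ [])) refl
    (a 0F) (a 1F) (a 2F) (a 3F) (a 4F) A (b 0F) (q 1F) (q 2F) (q 3F) (q 4F) (q 5F))
  coordinate (suc (suc 9F)) = trans (trans (b≡ 5F) (cong (λ z → q 5F ℤ.* + 3 ℤ.+ (a 0F ℤ.+ b 0F) ℤ.- z) a₅≡))
      (solve 12 (λ a₀ a₁ a₂ a₃ a₄ A b₀ q₁ q₂ q₃ q₄ q₅ → q₅ :* con (+ 3) :+ (a₀ :+ b₀) :-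
      (A :* con (+ 3) :- (a₀ :+ a₁ :+ a₂ :+ a₃ :+ a₄)) := rowᴾ (lookup K12-rows (suc (suc 9F)))
      (a₀ ∷ a₁ ∷ a₂ ∷ a₃ ∷ a₄ ∷ A ∷ b₀ ∷ q₁ ∷ q₂ ∷ q₃ ∷ q₄ ∷ q₅ ∷ [])) refl
    (a 0F) (a 1F) (a 2F) (a 3F) (a 4F) A (b 0F) (q 1F) (q 2F) (q 3F) (q 4F) (q 5F))

K12-preserved? : ∀ A → Dec (∀ k → (∀ i → apply A (ι ∘ K12-basis k) i ≡ ι (ℚ.numerator (apply A (ι ∘ K12-basis k) i)))
  × K12-condition (λ i → ℚ.numerator (apply A (ι ∘ K12-basis k) i)))
K12-preserved? A = Finₚ.all? λ k → Finₚ.all? (λ i → apply A (ι ∘ K12-basis k) i ℚₚ.≟ ι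
    (ℚ.numerator (apply A (ι ∘ K12-basis k) i)))
  ×-dec K12-condition? (λ i → ℚ.numerator (apply A (ι ∘ K12-basis k) i))

K12-preserved : ∀ A → {_ : True (K12-preserved? A)} → Preserves K12 A
K12-preserved A {w} = preserves-span K12-subgroup K12-basis K12-span A
  (λ k → (λ i → ℚ.numerator (apply A (ι ∘ K12-basis k) i)) , toWitness w k)

K12-multiplier : ∀ c → 1 ℕ.≤ c → HasMultiplier K12inner K12 (ι (+ c))
K12-multiplier = hasMultiplier eisenstein (inner-bilinear K12form) K12-action K12-subgroup
  (K12-preserved ω-matrix) (K12-preserved J-matrix)

open import Data.Nat using (ℕ; _≤_; _*_)
open import Data.Integer using (+_)
open import Data.Rational using (_/_)
open import Data.Product using (_×_)

theorem3 : ((m : ℕ) → 1 ≤ m → (c : ℕ) → 1 ≤ c →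
    HasMultiplier dot (Zlat (4 * m)) (+ c / 1)
    × HasMultiplier dot (Dlat (4 * m)) (+ c / 1)
    × HasMultiplier dot (Dplus (4 * m)) (+ c / 1))
    × ((c : ℕ) → 1 ≤ c →
    HasMultiplier dot E8 (+ c / 1)
    × HasMultiplier K12inner K12 (+ c / 1)
    × HasMultiplier dot BW16 (+ c / 1)
    × HasMultiplier dot Leech (+ c / 1))
theorem3 =
  (λ m _ c 1≤c → Zlat-multiplier m c 1≤c , Dlat-multiplier m c 1≤c , Dplus-multiplier m c 1≤c) ,
  (λ c 1≤c → Dplus-multiplier 2 c 1≤c , K12-multiplier c 1≤c , BW16-multiplier c 1≤c , Leech-multiplier c 1≤c)
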